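{- Let $G$ be a connected graph and let $\mathcal{T}$ be a set of $t$ pairwise edge-disjoint triangles of $G$ such that the subgraph of $G$ formed by the edge set $E(\mathcal{T})=\bigcup_{T\in\mathcal{T}}E(T)$ is a triangle-forest-structure. Then $rc(L(G))\leq n_2-t$, where $n_2$ is the number of vertices of $G$ of degree at least $2$. Moreover, the bound is sharp: for every positive integer $t$ there exist a connected graph $G$ and such a set $\mathcal{T}$ of $t$ triangles with $rc(L(G))=n_2-t$.
   Context: All graphs are simple, finite and undirected. $L(G)$ is the line graph of $G$. For an edge-colouring of a graph (adjacent edges may receive the same colour), a path is rainbow if no two of its edges have the same colour; the graph is rainbow connected if every two vertices are joined by a rainbow path. The rainbow connection number $rc(H)$ of a connected graph $H$ is the smallest number of colours in an edge-colouring making $H$ rainbow connected. A triangle-tree-structure is a connected graph every block of which is a triangle ($K_3$); a triangle-forest-structure is a graph each of whose connected components is a triangle-tree-structure. -}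

module Defs where

open import Data.Fin using (Fin; _<_)
open import Data.Fin.Properties using (_≟_; _<?_; any?)
open import Data.List using (List; []; _∷_; length; filter; allFin)
open import Data.List.Relation.Unary.Unique.Propositional using (Unique)
open import Data.Nat using (ℕ; _≤_; _≤?_)
open import Data.Product using (_×_; _,_; ∃; ∃-syntax; proj₁)
open import Data.Product.Properties using (≡-dec)
open import Data.Sum using (_⊎_)
open import Level using (0ℓ)
open import Relation.Binary.Core using (Rel)
open import Relation.Binary.Definitions using (Symmetric; Irreflexive)
  renaming (Decidable to Decidable₂)
open import Relation.Binary.PropositionalEquality using (_≡_; _≢_; sym)
open import Relation.Nullary using (¬_)
open import Relation.Nullary.Decidable using (¬?; _×-dec_; _⊎-dec_)
open import Relation.Unary using (Pred; Decidable)

-- A simple undirected graph whose vertex set is a decidable subset of the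
-- ambient type A, so that subgraphs of a graph on A are again graphs on A.
-- Finite graphs are those with finite A, such as Fin n or Fin n × Fin n.
record Graph (A : Set) : Set₁ where
  field
    Vertex     : Pred A 0ℓ
    vertex?    : Decidable Vertex
    Adj        : Rel A 0ℓ
    adj?       : Decidable₂ Adj
    adj-sym    : Symmetric Adj
    adj-irrefl : Irreflexive _≡_ Adj
    adj-vertex : ∀ {u v} → Adj u v → Vertex u

open Graph public

module _ {A : Set} where

  infix 4 _⊑_

  record _⊑_ (H G : Graph A) : Set where
    field
      vertex-⊑ : ∀ {v} → Vertex H v → Vertex G v
      adj-⊑    : ∀ {u v} → Adj H u v → Adj G u v

  data Walk (G : Graph A) : A → A → Set where
    stop : ∀ {u} → Vertex G u → Walk G u u
    step : ∀ {u v w} → Adj G u v → Walk G v w → Walk G u w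

  support : ∀ {G : Graph A} {u v} → Walk G u v → List A
  support {u = u} (stop _)   = u ∷ []
  support {u = u} (step _ p) = u ∷ support p

  IsPath : ∀ {G : Graph A} {u v} → Walk G u v → Set
  IsPath p = Unique (support p)

  Connected : Graph A → Set
  Connected G = ∃ (Vertex G) × (∀ u v → Vertex G u → Vertex G v → Walk G u v)

  Maximal : (Graph A → Set) → Graph A → Graph A → Set₁
  Maximal P G H =
    H ⊑ G × P H × (∀ H′ → H ⊑ H′ → H′ ⊑ G → P H′ → H′ ⊑ H)

  IsComponent : Graph A → Graph A → Set₁
  IsComponent = Maximal Connected

  -- a, b, c are distinct because adjacency is irreflexive.
  record IsTriangle (H : Graph A) : Set where
    field
      a b c    : A
      ab       : Adj H a b
      bc       : Adj H b c
      ca       : Adj H c a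
      only-abc : ∀ {v} → Vertex H v → v ≡ a ⊎ v ≡ b ⊎ v ≡ c

  EdgeDisjoint : Graph A → Graph A → Set
  EdgeDisjoint H K = ∀ u v → Adj H u v → ¬ Adj K u v

  -- The colour is a function of the edge alone: it is symmetric in the
  -- endpoints, and the adjacency proof is irrelevant.  That argument cannot be
  -- dropped, as an edgeless graph must have a colouring with no colours.
  record EdgeColouring (G : Graph A) (k : ℕ) : Set where
    field
      colour     : ∀ u v → .(Adj G u v) → Fin k
      colour-sym : ∀ u v .(p : Adj G u v) .(q : Adj G v u) →
                   colour u v p ≡ colour v u q

  open EdgeColouring public

  colours : ∀ {G : Graph A} {k u v} → EdgeColouring G k → Walk G u v → List (Fin k)
  colours χ (stop _)                   = []
  colours χ (step {u = u} {v = v} e p) = colour χ u v e ∷ colours χ p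

  RainbowConnected : (G : Graph A) {k : ℕ} → EdgeColouring G k → Set
  RainbowConnected G χ = ∀ u v → Vertex G u → Vertex G v →
    ∃[ p ] IsPath {G} {u} {v} p × Unique (colours χ p)

  RainbowColourable : Graph A → ℕ → Set
  RainbowColourable G k = ∃[ χ ] RainbowConnected G {k} χ

  -- "rc(G) = k", with rc as a (functional) relation.  Not every one of the k
  -- available colours has to be used, which does not affect the minimum.
  HasRC : Graph A → ℕ → Set
  HasRC G k = RainbowColourable G k × (∀ j → RainbowColourable G j → k ≤ j)

module _ {n : ℕ} where

  degree : Graph (Fin n) → Fin n → ℕ
  degree G v = length (filter (adj? G v) (allFin n))

  -- Elements of Fin n that are not vertices of G have degree 0.
  n₂ : Graph (Fin n) → ℕ
  n₂ G = length (filter (λ v → 2 ≤? degree G v) (allFin n))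

  infixl 6 _─_

  _─_ : Graph (Fin n) → Fin n → Graph (Fin n)
  G ─ x = record
    { Vertex     = λ u → Vertex G u × u ≢ x
    ; vertex?    = λ u → vertex? G u ×-dec ¬? (u ≟ x)
    ; Adj        = λ u v → Adj G u v × u ≢ x × v ≢ x
    ; adj?       = λ u v → adj? G u v ×-dec ¬? (u ≟ x) ×-dec ¬? (v ≟ x)
    ; adj-sym    = λ (e , p , q) → adj-sym G e , q , p
    ; adj-irrefl = λ eq (e , _) → adj-irrefl G eq e
    ; adj-vertex = λ (e , p , _) → adj-vertex G e , p
    }

  -- Deleting x disconnects two vertices that were joined before.
  IsCutVertex : Graph (Fin n) → Fin n → Set
  IsCutVertex G x = Vertex G x × ∃[ u ] ∃[ v ]
    (Vertex (G ─ x) u × Vertex (G ─ x) v × Walk G u v × ¬ Walk (G ─ x) u v)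

  Nonseparable : Graph (Fin n) → Set
  Nonseparable G = Connected G × (∀ x → ¬ IsCutVertex G x)

  IsBlock : Graph (Fin n) → Graph (Fin n) → Set₁
  IsBlock = Maximal Nonseparable

  IsTriangleTree : Graph (Fin n) → Set₁
  IsTriangleTree G = Connected G × (∀ B → IsBlock G B → IsTriangle B)

  IsTriangleForest : Graph (Fin n) → Set₁
  IsTriangleForest G = ∀ C → IsComponent G C → IsTriangleTree C

  -- The graph formed by the edges of all T i; its vertices are the endpoints
  -- of these edges.
  edgeUnion : ∀ {t} → (Fin t → Graph (Fin n)) → Graph (Fin n)
  edgeUnion T = record
    { Vertex     = λ u → ∃[ v ] ∃[ i ] Adj (T i) u v
    ; vertex?    = λ u → any? λ v → any? λ i → adj? (T i) u v
    ; Adj        = λ u v → ∃[ i ] Adj (T i) u v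
    ; adj?       = λ u v → any? λ i → adj? (T i) u v
    ; adj-sym    = λ (i , e) → i , adj-sym (T i) e
    ; adj-irrefl = λ eq (i , e) → adj-irrefl (T i) eq e
    ; adj-vertex = λ {_} {v} e → v , e
    }

  -- Triangles are subgraphs.  Edge-disjointness forces the T i to be distinct,
  -- so T enumerates a set of exactly t triangles.
  record ForestOfTriangles (G : Graph (Fin n)) {t : ℕ} (T : Fin t → Graph (Fin n)) : Set₁ where
    field
      subgraph : ∀ i → T i ⊑ G
      triangle : ∀ i → IsTriangle (T i)
      disjoint : ∀ i j → i ≢ j → EdgeDisjoint (T i) (T j)
      forest   : IsTriangleForest (edgeUnion T)

  _∈ᵉ_ : Fin n → Fin n × Fin n → Set
  x ∈ᵉ (u , v) = x ≡ u ⊎ x ≡ v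

  -- The edge {u , v} is represented once, by the pair (u , v) with u < v.
  IsEdge : Graph (Fin n) → Pred (Fin n × Fin n) 0ℓ
  IsEdge G (u , v) = u < v × Adj G u v

  L : Graph (Fin n) → Graph (Fin n × Fin n)
  L G = record
    { Vertex     = IsEdge G
    ; vertex?    = isEdge?
    ; Adj        = λ e f → IsEdge G e × IsEdge G f × e ≢ f × ∃[ x ] (x ∈ᵉ e × x ∈ᵉ f)
    ; adj?       = λ e f → isEdge? e ×-dec isEdge? f ×-dec ¬? (≡-dec _≟_ _≟_ e f)
                           ×-dec any? λ x → (x ∈ᵉ? e) ×-dec (x ∈ᵉ? f)
    ; adj-sym    = λ (p , q , e≢f , x , r , s) → q , p , (λ eq → e≢f (sym eq)) , x , s , r
    ; adj-irrefl = λ eq (_ , _ , e≢f , _) → e≢f eq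
    ; adj-vertex = proj₁
    }
    where
    isEdge? : Decidable (IsEdge G)
    isEdge? (u , v) = (u <? v) ×-dec adj? G u v

    _∈ᵉ?_ : Decidable₂ _∈ᵉ_
    x ∈ᵉ? (u , v) = (x ≟ u) ⊎-dec (x ≟ v)

{-# OPTIONS --safe #-}

-- In L(G), the pairs of edges meeting at a vertex v form a clique.  One private
-- colour for each clique of a vertex of degree at least 2 makes L(G) rainbow
-- connected; a triangle saves one colour.  Grow a vertex set from a root, adding
-- either a neighbour x of a reached vertex, with a new colour at x, or both
-- further corners x, y of a triangle with one reached corner p, with a single new
-- colour at x and y.  An edge at x or y reaches the old edges through px or py at
-- the cost of the new colour.  An edge at x and an edge at y are joined through
-- xy, provided that the turns at x between xy and edges other than xp reuse an
-- old colour; no earlier path uses these turns.  The forest condition guarantees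
-- that a triangle not yet added never has two reached corners.
--
-- For sharpness, take t disjoint triangles in a row, joined by single edges, with
-- a pendant edge at both ends: then n₂ = 3t, and the two pendant edges are at
-- distance 2t in L(G).
module Submission where

open import Data.Bool using (Bool; true; false; if_then_else_; _∧_; _∨_; not)
import Data.Bool.Properties as Bool
open import Data.Fin using (Fin; zero; suc; toℕ; fromℕ; fromℕ<; inject₁; combine; remQuot)
open import Data.Fin.Induction using (<-weakInduction)
import Data.Fin.Properties as Fin
open import Data.List
  using (List; []; _∷_; [_]; _++_; length; filter; map; lookup; reverse; allFin; cartesianProduct)
open import Data.List.Membership.Propositional using (_∈_; _∉_)
open import Data.List.Membership.Propositional.Properties
  using (∈-lookup; ∈-allFin; ∈-filter⁺; ∈-filter⁻; ∈-cartesianProduct⁺)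
open import Data.List.Properties
  using (length-filter; length-tabulate; unfold-reverse; filter-accept; filter-reject)
open import Data.List.Relation.Binary.Permutation.Propositional using (↭-sym; ↭⇒↭ₛ)
open import Data.List.Relation.Binary.Permutation.Propositional.Properties using (↭-reverse; All-resp-↭)
import Data.List.Relation.Binary.Permutation.Setoid.Properties as Permutation
open import Data.List.Relation.Binary.Sublist.Propositional
  using ([]; _∷_; _∷ʳ_; ⊆-refl; ⊆-trans)
  renaming (_⊆_ to Sublist; lookup to sublist-∈)
open import Data.List.Relation.Binary.Sublist.Propositional.Properties using (All-resp-⊆)
open import Data.List.Relation.Unary.All using (All; []; _∷_)
import Data.List.Relation.Unary.All as All
import Data.List.Relation.Unary.All.Properties as All
open import Data.List.Relation.Unary.AllPairs using ([]; _∷_)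
open import Data.List.Relation.Unary.Any using (here; there; index)
import Data.List.Relation.Unary.Any.Properties as Any
open import Data.List.Relation.Unary.Unique.Propositional using (Unique)
import Data.List.Relation.Unary.Unique.Propositional.Properties as Unique
open import Data.Nat using (ℕ; zero; suc; _+_; _*_; _≤_; _<_; z≤n; s≤s; _≤?_)
import Data.Nat.Properties as ℕ
open import Data.Product using (_×_; _,_; ∃; ∃-syntax; Σ-syntax; proj₁; proj₂)
open import Data.Sum using (_⊎_; inj₁; inj₂)
open import Data.Unit using (⊤; tt)
open import Data.Vec using (Vec; []; _∷_)
import Data.Vec as Vec
import Data.Vec.Properties as Vec
open import Function using (_∘_)
open import Level using (0ℓ)
open import Relation.Binary.Definitions using (DecidableEquality; tri<; tri≈; tri>)
open import Relation.Binary.PropositionalEquality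
  using (_≡_; _≢_; refl; sym; trans; cong; cong₂; subst; subst₂; ≢-sym; setoid)
open import Relation.Nullary using (¬_; Dec; yes; no; contradiction; does)
open import Relation.Nullary.Decidable
  using (map′; ¬?; _×-dec_; _⊎-dec_; _→-dec_; recompute; decidable-stable; dec-true; dec-false)
open import Relation.Unary using (Pred; Decidable)
open import Defs

open _⊑_

-- Lists and walks

module _ {A : Set} where

  unique-sublist : ∀ {xs ys : List A} → Sublist xs ys → Unique ys → Unique xs
  unique-sublist []         []       = []
  unique-sublist (_ ∷ʳ s)   (_ ∷ u)  = unique-sublist s u
  unique-sublist (refl ∷ s) (px ∷ u) = All-resp-⊆ s px ∷ unique-sublist s u

  unique-∷ : ∀ {x} {xs : List A} → x ∉ xs → Unique xs → Unique (x ∷ xs)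
  unique-∷ x∉xs u = All.¬Any⇒All¬ _ x∉xs ∷ u

  lookup-injective : ∀ {xs : List A} → Unique xs → ∀ {i j} → lookup xs i ≡ lookup xs j → i ≡ j
  lookup-injective (_ ∷ _)  {zero}  {zero}  _  = refl
  lookup-injective (px ∷ _) {zero}  {suc j} eq = contradiction eq (All.lookup px (∈-lookup j))
  lookup-injective (px ∷ _) {suc i} {zero}  eq = contradiction (sym eq) (All.lookup px (∈-lookup i))
  lookup-injective (_ ∷ u)  {suc i} {suc j} eq = cong suc (lookup-injective u eq)

  -- Pigeonhole: sending each position of `xs` to the position of its entry in `ys` is injective.
  -- Counting bounds and clashes of too many distinct vertices both come from here.
  unique-length : ∀ {xs ys : List A} → Unique xs → (∀ {x} → x ∈ xs → x ∈ ys) → length xs ≤ length ys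
  unique-length {xs} {ys} u xs⊆ys = Fin.injective⇒≤ {f = position} position-injective
    where
    position : Fin (length xs) → Fin (length ys)
    position i = index (xs⊆ys (∈-lookup i))

    position-injective : ∀ {i j} → position i ≡ position j → i ≡ j
    position-injective {i} {j} eq = lookup-injective u (trans (Any.lookup-index (xs⊆ys (∈-lookup i)))
      (trans (cong (lookup ys) eq) (sym (Any.lookup-index (xs⊆ys (∈-lookup j))))))

unique-Fin-length : ∀ {n} {xs : List (Fin n)} → Unique xs → length xs ≤ n
unique-Fin-length u = Fin.injective⇒≤ (lookup-injective u)

module _ {A : Set} where

  target-vertex : ∀ {G : Graph A} {u v} → Walk G u v → Vertex G v
  target-vertex (stop p)   = p
  target-vertex (step _ w) = target-vertex w

  edge-walk : ∀ {G : Graph A} {u v} → Adj G u v → Walk G u v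
  edge-walk {G} e = step e (stop (adj-vertex G (adj-sym G e)))

  infixr 5 _++ʷ_

  _++ʷ_ : ∀ {G : Graph A} {u v w} → Walk G u v → Walk G v w → Walk G u w
  stop _   ++ʷ q = q
  step e p ++ʷ q = step e (p ++ʷ q)

  reverse-walk : ∀ {G : Graph A} {u v} → Walk G u v → Walk G v u
  reverse-walk     (stop p)   = stop p
  reverse-walk {G} (step e w) = reverse-walk w ++ʷ edge-walk (adj-sym G e)

  map-walk : ∀ {H G : Graph A} → H ⊑ G → ∀ {u v} → Walk H u v → Walk G u v
  map-walk H⊑G (stop p)   = stop (_⊑_.vertex-⊑ H⊑G p)
  map-walk H⊑G (step e w) = step (_⊑_.adj-⊑ H⊑G e) (map-walk H⊑G w)

  ⊑-refl : ∀ {G : Graph A} → G ⊑ G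
  ⊑-refl = record { vertex-⊑ = λ p → p ; adj-⊑ = λ e → e }

  ⊑-trans : ∀ {G H K : Graph A} → G ⊑ H → H ⊑ K → G ⊑ K
  ⊑-trans p q = record { vertex-⊑ = vertex-⊑ q ∘ vertex-⊑ p ; adj-⊑ = adj-⊑ q ∘ adj-⊑ p }
    where open _⊑_

  source∈support : ∀ {G : Graph A} {u v} (p : Walk G u v) → u ∈ support p
  source∈support (stop _)   = here refl
  source∈support (step _ _) = here refl

  -- Support and colours are tracked as sublists because a sublist of a duplicate-free list is
  -- duplicate-free: shortening a walk keeps it a path and keeps it rainbow.
  walk-suffix : ∀ {G : Graph A} {k} (χ : EdgeColouring G k) {u v x} (p : Walk G u v) → x ∈ support p →
    ∃[ q ] (Sublist (support {G = G} {x} {v} q) (support p) × Sublist (colours χ q) (colours χ p))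
  walk-suffix χ (stop x)   (here refl) = stop x , ⊆-refl , ⊆-refl
  walk-suffix χ (step e p) (here refl) = step e p , ⊆-refl , ⊆-refl
  walk-suffix χ (step e p) (there x∈p) =
    let q , s , c = walk-suffix χ p x∈p in q , _ ∷ʳ s , _ ∷ʳ c

module _ {A : Set} (_≟_ : DecidableEquality A) where

  open import Data.List.Membership.DecPropositional _≟_ using (_∈?_)

  -- Loop erasure: if `u` recurs in the path already built, the walk restarts from that later visit.
  -- Rainbow walks may therefore replace rainbow paths in all constructions.
  walk⇒path : ∀ {G : Graph A} {k} (χ : EdgeColouring G k) {u v} (p : Walk G u v) →
    ∃[ q ] (IsPath {G = G} {u} {v} q × Sublist (colours χ q) (colours χ p))
  walk⇒path χ (stop x) = stop x , [] ∷ [] , []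
  walk⇒path χ (step {u = u} e p) with walk⇒path χ p
  ... | q , q-path , c with u ∈? support q
  ...   | no u∉q  = step e q , unique-∷ u∉q q-path , refl ∷ c
  ...   | yes u∈q = let r , s , d = walk-suffix χ q u∈q in
                    r , unique-sublist s q-path , _ ∷ʳ ⊆-trans d c

  rainbow-walk⇒path : ∀ {G : Graph A} {k} (χ : EdgeColouring G k) {u v} (p : Walk G u v) →
    Unique (colours χ p) → ∃[ q ] (IsPath {G = G} {u} {v} q × Unique (colours χ q))
  rainbow-walk⇒path χ p u = let q , q-path , c = walk⇒path χ p in q , q-path , unique-sublist c u

-- Deciding rainbow colourability

-- `HasRC` asks for a least number of colours. A colouring gives only an upper bound, so the minimum
-- is found by search, for which colourability must be decidable.
least : ∀ {P : Pred ℕ 0ℓ} → Decidable P → ∀ {n} → P n → ∃[ m ] (m ≤ n × P m × (∀ j → P j → m ≤ j))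
least P? {zero}  p = 0 , z≤n , p , λ _ _ → z≤n
least {P} P? {suc n} p with P? 0
... | yes p₀ = 0 , z≤n , p₀ , λ _ _ → z≤n
... | no ¬p₀ =
  let m , m≤n , pm , min = least (P? ∘ suc) p in
  suc m , s≤s m≤n , pm , λ { zero p₀ → contradiction p₀ ¬p₀ ; (suc j) pj → s≤s (min j pj) }

Exhaustible : Set → Set₁
Exhaustible B = ∀ {P : Pred B 0ℓ} → Decidable P → Dec (∃ P)

exhaustible-Vec : ∀ {B} → Exhaustible B → ∀ m → Exhaustible (Vec B m)
exhaustible-Vec any? zero    P? = map′ ([] ,_) (λ { ([] , p) → p }) (P? [])
exhaustible-Vec any? (suc m) P? =
  map′ (λ (b , bs , p) → b ∷ bs , p) (λ { (b ∷ bs , p) → b , bs , p })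
    (any? λ b → exhaustible-Vec any? m λ bs → P? (b ∷ bs))

module _ {A : Set} {G : Graph A} {k : ℕ} where

  _≗ᶜ_ : EdgeColouring G k → EdgeColouring G k → Set
  χ ≗ᶜ ψ = ∀ u v (e : Adj G u v) → colour χ u v e ≡ colour ψ u v e

  colours-cong : ∀ {χ ψ : EdgeColouring G k} → χ ≗ᶜ ψ →
    ∀ {u v} (p : Walk G u v) → colours χ p ≡ colours ψ p
  colours-cong eq (stop _)   = refl
  colours-cong eq (step e p) = cong₂ _∷_ (eq _ _ e) (colours-cong eq p)

  rainbowConnected-cong : ∀ {χ ψ : EdgeColouring G k} → χ ≗ᶜ ψ →
    RainbowConnected G χ → RainbowConnected G ψ
  rainbowConnected-cong eq rc u v u∈G v∈G =
    let p , p-path , unique = rc u v u∈G v∈G in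
    p , p-path , subst Unique (colours-cong eq p) unique

-- `A` is a retract of `Fin N`. The instance that matters is the vertex type `Fin n × Fin n` of a
-- line graph.
module _ {A : Set} {N : ℕ} (encode : A → Fin N) (decode : Fin N → A)
         (decode-encode : ∀ a → decode (encode a) ≡ a) where

  finite-≟ : DecidableEquality A
  finite-≟ a b = map′
    (λ eq → trans (sym (decode-encode a)) (trans (cong decode eq) (decode-encode b)))
    (cong encode) (encode a Fin.≟ encode b)

  finite-any? : Exhaustible A
  finite-any? {P} P? = map′ (λ (i , p) → decode i , p)
    (λ (a , p) → encode a , subst P (sym (decode-encode a)) p) (Fin.any? (P? ∘ decode))

  finite-all? : ∀ {P : Pred A 0ℓ} → Decidable P → Dec (∀ a → P a)
  finite-all? {P} P? = map′ (λ f a → subst P (decode-encode a) (f (encode a)))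
    (λ f i → f (decode i)) (Fin.all? (P? ∘ decode))

  module _ {G : Graph A} {k : ℕ} (χ : EdgeColouring G k) where

    open import Data.List.Membership.DecPropositional (Fin._≟_ {k}) using (_∈?_)

    -- The list `used` holds the colours spent so far, and `m` bounds the steps to come, so the
    -- search is structurally recursive.
    BoundedRainbowWalk : ℕ → List (Fin k) → A → A → Set
    BoundedRainbowWalk m used u v = Σ[ p ∈ Walk G u v ]
      (Unique (colours χ p) × All (_∉ used) (colours χ p) × length (colours χ p) ≤ m)

    boundedRainbowWalk? : ∀ m used u v → Vertex G u → Dec (BoundedRainbowWalk m used u v)
    boundedRainbowWalk? m used u v u∈G with finite-≟ u v
    boundedRainbowWalk? m used u v u∈G | yes refl = yes (stop u∈G , [] , [] , z≤n)
    boundedRainbowWalk? zero used u v u∈G | no u≢v =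
      no λ { (stop _ , _) → u≢v refl ; (step _ _ , _ , _ , ()) }
    boundedRainbowWalk? (suc m) used u v u∈G | no u≢v =
      map′ extend first (finite-any? firstStep?)
      where
      FirstStep : Pred A 0ℓ
      FirstStep w = Σ[ e ∈ Adj G u w ]
        (colour χ u w e ∉ used × BoundedRainbowWalk m (colour χ u w e ∷ used) w v)

      firstStep? : Decidable FirstStep
      firstStep? w with adj? G u w
      ... | no ¬e = no (¬e ∘ proj₁)
      ... | yes e with colour χ u w e ∈? used
                     | boundedRainbowWalk? m (colour χ u w e ∷ used) w v (adj-vertex G (adj-sym G e))
      ...   | yes c∈ | _     = no λ (_ , c∉ , _) → c∉ c∈
      ...   | no  _  | no ¬p = no λ (_ , _ , p) → ¬p p
      ...   | no  c∉ | yes p = yes (e , c∉ , p)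

      extend : ∃ FirstStep → BoundedRainbowWalk (suc m) used u v
      extend (w , e , c∉ , p , unique , avoids , short) =
        step e p , All.map (λ d∉ eq → d∉ (here (sym eq))) avoids ∷ unique ,
        c∉ ∷ All.map (_∘ there) avoids , s≤s short

      first : BoundedRainbowWalk (suc m) used u v → ∃ FirstStep
      first (stop _ , _) = contradiction refl u≢v
      first (step e p , new ∷ unique , c∉ ∷ avoids , s≤s short) =
        _ , e , c∉ , p , unique ,
        All.zipWith (λ { (c≢d , d∉) → λ { (here eq) → c≢d (sym eq) ; (there d∈) → d∉ d∈ } })
          (new , avoids) , short

    rainbowPath? : ∀ u v → Vertex G u → Dec (Σ[ p ∈ Walk G u v ] (IsPath {G = G} p × Unique (colours χ p)))
    rainbowPath? u v u∈G = map′
      (λ (p , unique , _) → rainbow-walk⇒path finite-≟ χ p unique)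
      -- A rainbow walk has at most `k` edges, so the bound `k` on the search loses none.
      (λ (p , _ , unique) → p , unique , All.tabulate (λ _ ()) , unique-Fin-length unique)
      (boundedRainbowWalk? k [] u v u∈G)

    rainbowConnected? : Dec (RainbowConnected G χ)
    rainbowConnected? = finite-all? λ u → finite-all? λ v → joined? u v
      where
      joined? : ∀ u v → Dec (Vertex G u → Vertex G v → ∃[ p ] (IsPath {G = G} {u} {v} p × Unique (colours χ p)))
      joined? u v with vertex? G u
      ... | no u∉G = yes λ u∈G → contradiction u∈G u∉G
      ... | yes u∈G with vertex? G v
      ...   | no v∉G = yes λ _ v∈G → contradiction v∈G v∉G
      ...   | yes v∈G = map′ (λ p _ _ → p) (λ f → f u∈G v∈G) (rainbowPath? u v u∈G)

  module _ (G : Graph A) (k : ℕ) where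

    -- One value more than there are colours keeps the search space inhabited
    -- when k = 0 and G has no edges.
    Table : Set
    Table = Vec (Vec (Fin (suc k)) N) N

    entry : Table → A → A → ℕ
    entry t u v = toℕ (Vec.lookup (Vec.lookup t (encode u)) (encode v))

    Proper : Table → Set
    Proper t = ∀ u v → Adj G u v → entry t u v < k × entry t u v ≡ entry t v u

    proper? : Decidable Proper
    proper? t = finite-all? λ u → finite-all? λ v →
      adj? G u v →-dec ((entry t u v ℕ.<? k) ×-dec (entry t u v ℕ.≟ entry t v u))

    decodeTable : ∀ t → Proper t → EdgeColouring G k
    decodeTable t proper = record
      { colour     = λ u v e → fromℕ< (proj₁ (proper u v e))
      ; colour-sym = λ u v e e′ → Fin.fromℕ<-cong _ _
          -- The adjacency proofs are irrelevant here, so the equality is recovered from its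
          -- decidability.
          (recompute (entry t u v ℕ.≟ entry t v u) (proj₂ (proper u v e)))
          (proj₁ (proper u v e)) (proj₁ (proper v u e′))
      }

    module _ (χ : EdgeColouring G k) where

      value : A → A → Fin (suc k)
      value u v with adj? G u v
      ... | yes e = inject₁ (colour χ u v e)
      -- A placeholder: `Proper` constrains entries at adjacent pairs only.
      ... | no _  = zero

      value-adj : ∀ u v (e : Adj G u v) → value u v ≡ inject₁ (colour χ u v e)
      value-adj u v e with adj? G u v
      ... | yes _ = refl
      ... | no ¬e = contradiction e ¬e

      encodeTable : Table
      encodeTable = Vec.tabulate λ i → Vec.tabulate λ j → value (decode i) (decode j)

      entry-encodeTable : ∀ u v (e : Adj G u v) → entry encodeTable u v ≡ toℕ (colour χ u v e)
      entry-encodeTable u v e = trans (cong toℕ (trans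
        (cong (λ row → Vec.lookup row (encode v)) (Vec.lookup∘tabulate _ (encode u)))
        (trans (Vec.lookup∘tabulate _ (encode v))
        (trans (cong₂ value (decode-encode u) (decode-encode v)) (value-adj u v e)))))
        (Fin.toℕ-inject₁ _)

      encodeTable-proper : Proper encodeTable
      encodeTable-proper u v e =
        subst (_< k) (sym (entry-encodeTable u v e)) (Fin.toℕ<n _) ,
        trans (entry-encodeTable u v e) (trans (cong toℕ (colour-sym χ u v e (adj-sym G e)))
          (sym (entry-encodeTable v u (adj-sym G e))))

      decode-encodeTable : χ ≗ᶜ decodeTable encodeTable encodeTable-proper
      decode-encodeTable u v e = Fin.toℕ-injective
        (trans (sym (entry-encodeTable u v e)) (sym (Fin.toℕ-fromℕ< _)))

    rainbowColourable? : Dec (RainbowColourable G k)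
    rainbowColourable? = map′
      (λ (t , proper , rc) → decodeTable t proper , rc)
      (λ (χ , rc) → encodeTable χ , encodeTable-proper χ ,
                    rainbowConnected-cong {ψ = decodeTable (encodeTable χ) (encodeTable-proper χ)}
                      (decode-encodeTable χ) rc)
      (exhaustible-Vec (exhaustible-Vec Fin.any? N) N colourable-by?)
      where
      colourable-by? : Decidable λ t → Σ[ proper ∈ Proper t ] RainbowConnected G (decodeTable t proper)
      colourable-by? t with proper? t
      ... | no ¬proper = no (¬proper ∘ proj₁)
      ... | yes proper = map′ (proper ,_)
        -- Colours depend on the table alone and not on the proof of properness, so both decodings
        -- agree by `refl`.
        (λ (proper′ , rc) → rainbowConnected-cong {χ = decodeTable t proper′} (λ _ _ _ → refl) rc)
        (rainbowConnected? (decodeTable t proper))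

  hasRC-bound : ∀ {G : Graph A} {k} → RainbowColourable G k → ∃[ m ] (HasRC G m × m ≤ k)
  hasRC-bound {G} colourable =
    let m , m≤k , cm , min = least (rainbowColourable? G) colourable in m , (cm , min) , m≤k

-- Triangle forests

-- A dummy colouring that makes the walk lemmas, stated for coloured graphs, available for plain
-- ones.
monochromatic : ∀ {A} {G : Graph A} → EdgeColouring G 1
monochromatic = record { colour = λ _ _ _ → zero ; colour-sym = λ _ _ _ _ → refl }

-- Counting, graph sizes and maximal subgraphs

module _ {A : Set} {P Q : Pred A 0ℓ} (P? : Decidable P) (Q? : Decidable Q)
         {xs : List A} (unique : Unique xs) (P⊆Q : ∀ {x} → P x → Q x) where

  private
    filter-⊆ : ∀ {x} → x ∈ filter P? xs → x ∈ filter Q? xs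
    filter-⊆ x∈ = let x∈xs , px = ∈-filter⁻ P? {xs = xs} x∈ in ∈-filter⁺ Q? x∈xs (P⊆Q px)

  count-mono-≤ : length (filter P? xs) ≤ length (filter Q? xs)
  count-mono-≤ = unique-length (Unique.filter⁺ P? unique) filter-⊆

  count-mono-< : ∀ {y} → y ∈ xs → Q y → ¬ P y → length (filter P? xs) < length (filter Q? xs)
  count-mono-< {y} y∈xs qy ¬py = unique-length
    (unique-∷ (¬py ∘ proj₂ ∘ ∈-filter⁻ P? {xs = xs}) (Unique.filter⁺ P? unique))
    λ { (here refl) → ∈-filter⁺ Q? y∈xs qy ; (there x∈) → filter-⊆ x∈ }

module _ {n : ℕ} where

  pairs : List (Fin n × Fin n)
  pairs = cartesianProduct (allFin n) (allFin n)

  pairs-unique : Unique pairs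
  pairs-unique = Unique.cartesianProduct⁺ (Unique.allFin⁺ n) (Unique.allFin⁺ n)

  -- The measure for the search of maximal subgraphs: a proper extension gains a vertex or an
  -- adjacency, hence is strictly larger.
  size : Graph (Fin n) → ℕ
  size H = length (filter (vertex? H) (allFin n)) + length (filter (λ (u , v) → adj? H u v) pairs)

  maxSize : ℕ
  maxSize = length (allFin n) + length pairs

  size≤maxSize : ∀ H → size H ≤ maxSize
  size≤maxSize H = ℕ.+-mono-≤ (length-filter (vertex? H) (allFin n)) (length-filter _ pairs)

  module _ {H K : Graph (Fin n)} (H⊑K : H ⊑ K) where

    private
      vertices-≤ : length (filter (vertex? H) (allFin n)) ≤ length (filter (vertex? K) (allFin n))
      vertices-≤ = count-mono-≤ (vertex? H) (vertex? K) (Unique.allFin⁺ n) (vertex-⊑ H⊑K)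

    size-vertex-< : ∀ {v} → Vertex K v → ¬ Vertex H v → size H < size K
    size-vertex-< v∈K v∉H = ℕ.+-mono-<-≤
      (count-mono-< (vertex? H) (vertex? K) (Unique.allFin⁺ n) (vertex-⊑ H⊑K) (∈-allFin _) v∈K v∉H)
      (count-mono-≤ (λ (u , v) → adj? H u v) (λ (u , v) → adj? K u v) pairs-unique (adj-⊑ H⊑K))

    size-adj-< : ∀ {u v} → Adj K u v → ¬ Adj H u v → size H < size K
    size-adj-< e ¬e = ℕ.+-mono-≤-< vertices-≤
      (count-mono-< (λ (u , v) → adj? H u v) (λ (u , v) → adj? K u v) pairs-unique (adj-⊑ H⊑K)
        (∈-cartesianProduct⁺ (∈-allFin _) (∈-allFin _)) e ¬e)

  module _ {P : Graph (Fin n) → Set} {G : Graph (Fin n)} where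

    -- P is not assumed decidable, hence the double negation.
    ¬¬maximal : ∀ {H} → H ⊑ G → P H → ¬ ¬ (∃[ M ] (H ⊑ M × Maximal P G M))
    ¬¬maximal = go maxSize (ℕ.m≤m+n maxSize _)
      where
      go : ∀ m {H} → maxSize ≤ m + size H → H ⊑ G → P H → ¬ ¬ (∃[ M ] (H ⊑ M × Maximal P G M))
      -- `H` itself is offered as maximal. A competitor with a vertex or an adjacency outside `H` is
      -- strictly larger, and the recursion from it, with less room `m` left, refutes `none`.
      go m {H} large H⊑G pH none = none (H , ⊑-refl , H⊑G , pH , λ K H⊑K K⊑G pK → record
        { vertex-⊑ = λ {v} v∈K → decidable-stable (vertex? H v) (¬larger m large H⊑K K⊑G pK ∘ size-vertex-< H⊑K v∈K)
        ; adj-⊑    = λ {u} {v} e → decidable-stable (adj? H u v) (¬larger m large H⊑K K⊑G pK ∘ size-adj-< H⊑K e)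
        })
        where
        ¬larger : ∀ m {K} → maxSize ≤ m + size H → H ⊑ K → K ⊑ G → P K → ¬ (size H < size K)
        ¬larger zero    {K} large _ _ _ H<K = ℕ.<⇒≱ (ℕ.<-≤-trans H<K (size≤maxSize K)) large
        ¬larger (suc m) {K} large H⊑K K⊑G pK H<K =
          go m (ℕ.≤-trans large (ℕ.≤-trans (ℕ.≤-reflexive (sym (ℕ.+-suc m _))) (ℕ.+-monoʳ-≤ m H<K)))
             K⊑G pK λ (M , K⊑M , max) → none (M , ⊑-trans H⊑K K⊑M , max)

  open import Data.List.Membership.DecPropositional (Fin._≟_ {n}) using (_∈?_)

  induced : Graph (Fin n) → List (Fin n) → Graph (Fin n)
  induced G M = record
    { Vertex     = λ u → Vertex G u × u ∈ M
    ; vertex?    = λ u → vertex? G u ×-dec u ∈? M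
    ; Adj        = λ u v → Adj G u v × u ∈ M × v ∈ M
    ; adj?       = λ u v → adj? G u v ×-dec u ∈? M ×-dec v ∈? M
    ; adj-sym    = λ (e , p , q) → adj-sym G e , q , p
    ; adj-irrefl = λ eq (e , _) → adj-irrefl G eq e
    ; adj-vertex = λ (e , p , _) → adj-vertex G e , p
    }

  -- `edgeUnion` restricted to the triangles in `S`; it serves both for all triangles but one and
  -- for the triangles absorbed so far.
  selected : ∀ {t} {S : Pred (Fin t) 0ℓ} → Decidable S → (Fin t → Graph (Fin n)) → Graph (Fin n)
  selected {S = S} S? T = record
    { Vertex     = λ u → ∃[ v ] ∃[ i ] (S i × Adj (T i) u v)
    ; vertex?    = λ u → Fin.any? λ v → Fin.any? λ i → S? i ×-dec adj? (T i) u v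
    ; Adj        = λ u v → ∃[ i ] (S i × Adj (T i) u v)
    ; adj?       = λ u v → Fin.any? λ i → S? i ×-dec adj? (T i) u v
    ; adj-sym    = λ (i , s , e) → i , s , adj-sym (T i) e
    ; adj-irrefl = λ eq (i , _ , e) → adj-irrefl (T i) eq e
    ; adj-vertex = λ {_} {v} e → v , e
    }

  selected-mono : ∀ {t} {S R : Pred (Fin t) 0ℓ} (S? : Decidable S) (R? : Decidable R)
    (T : Fin t → Graph (Fin n)) → (∀ {i} → S i → R i) → selected S? T ⊑ selected R? T
  selected-mono _ _ _ S⊆R = record
    { vertex-⊑ = λ (v , i , s , e) → v , i , S⊆R s , e
    ; adj-⊑    = λ (i , s , e) → i , S⊆R s , e
    }

  ─-⊑ : ∀ {G : Graph (Fin n)} {x} → (G ─ x) ⊑ G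
  ─-⊑ = record { vertex-⊑ = proj₁ ; adj-⊑ = proj₁ }

  -- A path visits `x` at most once, so `x` cannot lie both before and after `u`: one of the two
  -- parts of the path avoids it.
  ∉-split : ∀ {G : Graph (Fin n)} {a b u x} (p : Walk G a b) → IsPath {G = G} p → u ∈ support p → u ≢ x →
    (Σ[ q ∈ Walk G a u ] (x ∉ support q × (∀ {y} → y ∈ support q → y ∈ support p))) ⊎
    (Σ[ q ∈ Walk G u b ] (x ∉ support q × (∀ {y} → y ∈ support q → y ∈ support p)))
  ∉-split (stop a∈G) _ (here refl) u≢x = inj₁ (stop a∈G , (λ { (here eq) → u≢x (sym eq) }) , λ y∈ → y∈)
  ∉-split {G} (step e p) _ (here refl) u≢x =
    inj₁ (stop (adj-vertex G e) , (λ { (here eq) → u≢x (sym eq) }) , λ { (here eq) → here eq })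
  ∉-split {G} {x = x} (step {u = a} e p) (a# ∷ path) (there u∈p) u≢x with a Fin.≟ x
  ... | yes refl =
    let q , q⊆p , _ = walk-suffix monochromatic p u∈p in
    inj₂ (q , (λ a∈q → All.All¬⇒¬Any a# (sublist-∈ q⊆p a∈q)) , there ∘ sublist-∈ q⊆p)
  ... | no a≢x with ∉-split p path u∈p u≢x
  ...   | inj₁ (q , x∉q , q⊆p) = inj₁ (step e q , (λ { (here eq) → a≢x (sym eq) ; (there x∈q) → x∉q x∈q }) ,
                                    λ { (here eq) → here eq ; (there y∈) → there (q⊆p y∈) })
  ...   | inj₂ (q , x∉q , q⊆p) = inj₂ (q , x∉q , there ∘ q⊆p)

  module Triangle {H : Graph (Fin n)} (tri : IsTriangle H) where
    open IsTriangle tri public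

    corners : List (Fin n)
    corners = a ∷ b ∷ c ∷ []

    vertex⇒corner : ∀ {v} → Vertex H v → v ∈ corners
    vertex⇒corner v∈H with only-abc v∈H
    ... | inj₁ eq        = here eq
    ... | inj₂ (inj₁ eq) = there (here eq)
    ... | inj₂ (inj₂ eq) = there (there (here eq))

    corner⇒vertex : ∀ {v} → v ∈ corners → Vertex H v
    corner⇒vertex (here refl)                 = adj-vertex H ab
    corner⇒vertex (there (here refl))         = adj-vertex H bc
    corner⇒vertex (there (there (here refl))) = adj-vertex H ca

    corners-unique : Unique corners
    corners-unique = ((λ eq → adj-irrefl H eq ab) ∷ (λ eq → adj-irrefl H (sym eq) ca) ∷ []) ∷
                     ((λ eq → adj-irrefl H eq bc) ∷ []) ∷ [] ∷ []

    rotate : ∀ {p} → Vertex H p → ∃[ x ] ∃[ y ] (Adj H p x × Adj H p y × Adj H x y ×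
      (∀ {v} → Vertex H v → v ≡ p ⊎ v ≡ x ⊎ v ≡ y))
    rotate p∈H with only-abc p∈H
    ... | inj₁ refl = b , c , ab , adj-sym H ca , bc , only-abc
    ... | inj₂ (inj₁ refl) = c , a , bc , adj-sym H ab , ca , λ v∈ → swap (only-abc v∈)
      where
      swap : ∀ {X Y Z : Set} → X ⊎ Y ⊎ Z → Y ⊎ Z ⊎ X
      swap (inj₁ x)        = inj₂ (inj₂ x)
      swap (inj₂ (inj₁ y)) = inj₁ y
      swap (inj₂ (inj₂ z)) = inj₂ (inj₁ z)
    ... | inj₂ (inj₂ refl) = a , b , ca , adj-sym H bc , ab , λ v∈ → swap (only-abc v∈)
      where
      swap : ∀ {X Y Z : Set} → X ⊎ Y ⊎ Z → Z ⊎ X ⊎ Y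
      swap (inj₁ x)        = inj₂ (inj₁ x)
      swap (inj₂ (inj₁ y)) = inj₂ (inj₂ y)
      swap (inj₂ (inj₂ z)) = inj₁ z

    complete : ∀ {u v} → Vertex H u → Vertex H v → u ≢ v → Adj H u v
    complete u∈H v∈H u≢v with rotate u∈H
    ... | x , y , ux , uy , _ , only with only v∈H
    ...   | inj₁ refl        = contradiction refl u≢v
    ...   | inj₂ (inj₁ refl) = ux
    ...   | inj₂ (inj₂ refl) = uy

    corner-avoiding : ∀ u v → ∃[ x ] (Vertex H x × u ≢ x × v ≢ x)
    corner-avoiding u v with Fin.any? (λ x → vertex? H x ×-dec ¬? (u Fin.≟ x) ×-dec ¬? (v Fin.≟ x))
    ... | yes found = found
    ... | no  none  = contradiction (unique-length corners-unique covered) λ { (s≤s (s≤s ())) }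
      where
      covered : ∀ {x} → x ∈ corners → x ∈ u ∷ v ∷ []
      covered {x} x∈ with u Fin.≟ x | v Fin.≟ x
      ... | yes refl | _        = here refl
      ... | no _     | yes refl = there (here refl)
      ... | no u≢x   | no v≢x   = contradiction (x , corner⇒vertex x∈ , u≢x , v≢x) none

module _ {n} {G : Graph (Fin n)} {t} {T : Fin t → Graph (Fin n)} (F : ForestOfTriangles G T) where
  open ForestOfTriangles F

  others : Fin t → Graph (Fin n)
  others i = selected (λ j → ¬? (j Fin.≟ i)) T

  -- A path between two corners of T i outside of T i would form with T i a
  -- nonseparable graph with at least four vertices, yet every block is a triangle.
  no-path-between-corners : ∀ {i a b} → Vertex (T i) a → Vertex (T i) b → a ≢ b →
    (p : Walk (others i) a b) → ¬ IsPath {G = others i} p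
  no-path-between-corners a∈ b∈ a≢b (stop _) _ = a≢b refl
  no-path-between-corners {i} {a} {b} a∈ b∈ a≢b p@(step {v = w} (j , j≢i , aw) p′) path =
    -- The goal is absurdity, so a component `C` containing `H`, and then a block `B` of `C`
    -- containing `H`, may be taken from under the double negations.
    ¬¬maximal {P = Connected} H⊑U H-connected λ (C , H⊑C , component) →
    ¬¬maximal {P = Nonseparable} H⊑C H-nonseparable λ (B , H⊑B , block) →
    let B-triangle = proj₂ (forest C component) B block
        module Block = Triangle B-triangle
        in-B : ∀ {x} → x ∈ w ∷ corners → x ∈ Block.corners
        in-B = λ { (here refl) → Block.vertex⇒corner (vertex-⊑ H⊑B w∈H)
                 ; (there x∈)  → Block.vertex⇒corner (vertex-⊑ H⊑B (corner∈H x∈)) }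
    -- The three corners of `T i` and `w` are four distinct vertices of the triangle `B`.
    in contradiction (unique-length (unique-∷ w∉corners corners-unique) in-B) λ { (s≤s (s≤s (s≤s ()))) }
    where
    open Triangle (triangle i) hiding (a; b)

    U = edgeUnion T
    M = corners ++ support p
    H = induced U M

    ∈M-left : ∀ {x} → x ∈ corners → x ∈ M
    ∈M-left = Any.++⁺ˡ
    ∈M-right : ∀ {x} → x ∈ support p → x ∈ M
    ∈M-right = Any.++⁺ʳ corners

    w∉corners : w ∉ corners
    -- Otherwise the edge `aw` of `T j` would also be an edge of `T i`.
    w∉corners w∈ = disjoint j i j≢i a w aw
      (complete a∈ (corner⇒vertex w∈) λ eq → adj-irrefl (T j) eq aw)

    H⊑U : H ⊑ U
    H⊑U = record { vertex-⊑ = proj₁ ; adj-⊑ = proj₁ }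

    T-vertex∈U : ∀ {x} → Vertex (T i) x → Vertex U x
    T-vertex∈U {x} x∈ = let y , y∈ , x≢y , _ = corner-avoiding x x in y , i , complete x∈ y∈ x≢y

    corner∈H : ∀ {x} → x ∈ corners → Vertex H x
    corner∈H x∈ = T-vertex∈U (corner⇒vertex x∈) , ∈M-left x∈

    w∈H : Vertex H w
    w∈H = (a , j , adj-sym (T j) aw) , ∈M-right (there (source∈support p′))

    avoiding : ∀ {x u v} (q : Walk (others i) u v) → x ∉ support q →
      (∀ {y} → y ∈ support q → y ∈ support p) → Walk (H ─ x) u v
    avoiding (stop (y , k , _ , e)) x∉ ⊆p =
      stop (((y , k , e) , ∈M-right (⊆p (here refl))) , λ eq → x∉ (here (sym eq)))
    avoiding (step (k , _ , e) q) x∉ ⊆p = step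
      (((k , e) , ∈M-right (⊆p (here refl)) , ∈M-right (⊆p (there (source∈support q)))) ,
       (λ eq → x∉ (here (sym eq))) ,
       (λ eq → x∉ (there (subst (_∈ support q) eq (source∈support q)))))
      (avoiding q (x∉ ∘ there) (⊆p ∘ there))

    -- A vertex of the path that survives the deletion of `x` can follow the path towards `a` or
    -- towards `b`, whichever part avoids `x`; both ends are corners.
    to-corner : ∀ {x u} → Vertex H u → u ≢ x → ∃[ v ] (v ∈ corners × Walk (H ─ x) u v)
    to-corner {x} {u} (u∈U , u∈M) u≢x with Any.++⁻ corners u∈M
    ... | inj₁ u∈corners = u , u∈corners , stop ((u∈U , u∈M) , u≢x)
    ... | inj₂ u∈p with ∉-split p path u∈p u≢x
    ...   | inj₁ (q , x∉q , q⊆p) = a , vertex⇒corner a∈ , reverse-walk (avoiding q x∉q q⊆p)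
    ...   | inj₂ (q , x∉q , q⊆p) = b , vertex⇒corner b∈ , avoiding q x∉q q⊆p

    between-corners : ∀ {x u v} → u ∈ corners → v ∈ corners → u ≢ x → v ≢ x → Walk (H ─ x) u v
    between-corners {u = u} {v} u∈ v∈ u≢x v≢x with u Fin.≟ v
    ... | yes refl = stop (corner∈H u∈ , u≢x)
    ... | no u≢v   = edge-walk {G = H ─ _}
      (((i , complete (corner⇒vertex u∈) (corner⇒vertex v∈) u≢v) , ∈M-left u∈ , ∈M-left v∈) , u≢x , v≢x)

    joined : ∀ {x u v} → Vertex H u → Vertex H v → u ≢ x → v ≢ x → Walk (H ─ x) u v
    joined u∈H v∈H u≢x v≢x =
      let c , c∈ , p = to-corner u∈H u≢x
          d , d∈ , q = to-corner v∈H v≢x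
      in p ++ʷ between-corners c∈ d∈ (proj₂ (target-vertex p)) (proj₂ (target-vertex q)) ++ʷ reverse-walk q

    H-connected : Connected H
    H-connected = (w , w∈H) , λ u v u∈H v∈H →
      -- Some corner differs from `u` and `v`; they remain joined even after its deletion, so
      -- connectedness follows from the same walks.
      let x , _ , u≢x , v≢x = corner-avoiding u v in map-walk ─-⊑ (joined u∈H v∈H u≢x v≢x)

    H-nonseparable : Nonseparable H
    H-nonseparable = H-connected , λ x (_ , u , v , (u∈H , u≢x) , (v∈H , v≢x) , _ , ¬walk) →
      ¬walk (joined u∈H v∈H u≢x v≢x)

  -- Loop erasure extends the previous result from paths to walks, the form in which the forest
  -- condition enters the growth argument.
  corners-separated : ∀ {i a b} → Vertex (T i) a → Vertex (T i) b → a ≢ b → ¬ Walk (others i) a b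
  corners-separated {i} a∈ b∈ a≢b p =
    let q , path , _ = walk⇒path Fin._≟_ monochromatic p in no-path-between-corners a∈ b∈ a≢b q path

-- Turn colourings and the line graph

-- The ordered representative required by `IsEdge`. For equal vertices, which are never adjacent,
-- the value is arbitrary.
edge : ∀ {n} → Fin n → Fin n → Fin n × Fin n
edge u v with Fin.<-cmp u v
... | tri< _ _ _ = u , v
... | tri≈ _ _ _ = u , v
... | tri> _ _ _ = v , u

module _ {n : ℕ} where

  edge-< : ∀ {u v : Fin n} → toℕ u < toℕ v → edge u v ≡ (u , v)
  edge-< {u} {v} u<v with Fin.<-cmp u v
  ... | tri< _ _ _   = refl
  ... | tri≈ _ _ _   = refl
  ... | tri> u≮v _ _ = contradiction u<v u≮v

  edge-> : ∀ {u v : Fin n} → toℕ v < toℕ u → edge u v ≡ (v , u)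
  edge-> {u} {v} v<u with Fin.<-cmp u v
  ... | tri< _ _ v≮u = contradiction v<u v≮u
  ... | tri≈ _ _ v≮u = contradiction v<u v≮u
  ... | tri> _ _ _   = refl

  edge-comm : ∀ (u v : Fin n) → edge u v ≡ edge v u
  edge-comm u v with Fin.<-cmp u v
  ... | tri< u<v _ _   = sym (edge-> u<v)
  ... | tri≈ _ refl _  = sym (edge-refl u)
    where
    edge-refl : ∀ u → edge u u ≡ (u , u)
    edge-refl u with Fin.<-cmp u u
    ... | tri< _ _ _ = refl
    ... | tri≈ _ _ _ = refl
    ... | tri> _ _ _ = refl
  ... | tri> _ _ v<u   = sym (edge-< v<u)

  edge-injectiveʳ : ∀ {v a b : Fin n} → edge v a ≡ edge v b → a ≡ b
  edge-injectiveʳ {v} {a} {b} eq with Fin.<-cmp v a | Fin.<-cmp v b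
  ... | tri< _ _ _    | tri< _ _ _    = cong proj₂ eq
  ... | tri< _ _ _    | tri≈ _ _ _    = cong proj₂ eq
  ... | tri< _ v≢a _  | tri> _ _ _    = contradiction (sym (cong proj₂ eq)) v≢a
  ... | tri≈ _ _ _    | tri< _ _ _    = cong proj₂ eq
  ... | tri≈ _ _ _    | tri≈ _ _ _    = cong proj₂ eq
  ... | tri≈ _ refl _ | tri> _ _ _    = cong proj₁ eq
  ... | tri> _ _ _    | tri< _ v≢b _  = contradiction (cong proj₂ eq) v≢b
  ... | tri> _ _ _    | tri≈ _ refl _ = cong proj₁ eq
  ... | tri> _ _ _    | tri> _ _ _    = cong proj₁ eq

  ∈ᵉ-edge : ∀ (v a : Fin n) → v ∈ᵉ edge v a
  ∈ᵉ-edge v a with Fin.<-cmp v a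
  ... | tri< _ _ _ = inj₁ refl
  ... | tri≈ _ _ _ = inj₁ refl
  ... | tri> _ _ _ = inj₂ refl

  -- γ v a b is the colour of the edge of L G that joins va and vb.
  TurnColouring : Set
  TurnColouring = Fin n → Fin n → Fin n → ℕ

  SymmetricTurns : TurnColouring → Set
  SymmetricTurns γ = ∀ v a b → γ v a b ≡ γ v b a

  override : Fin n → (Fin n → Fin n → ℕ) → TurnColouring → TurnColouring
  override x f γ v = if does (v Fin.≟ x) then f else γ v

  override-at : ∀ x f γ → override x f γ x ≡ f
  override-at x f γ rewrite dec-true (x Fin.≟ x) refl = refl

  override-off : ∀ {x v : Fin n} f (γ : TurnColouring) → v ≢ x → override x f γ v ≡ γ v
  override-off {x} {v} f γ v≢x rewrite dec-false (v Fin.≟ x) v≢x = refl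

  override-sym : ∀ x {f γ} → (∀ a b → f a b ≡ f b a) → SymmetricTurns γ → SymmetricTurns (override x f γ)
  override-sym x f-sym γ-sym v a b with does (v Fin.≟ x)
  ... | true  = f-sym a b
  ... | false = γ-sym v a b

module _ {n : ℕ} (G : Graph (Fin n)) where

  isEdge-edge : ∀ {u v} → Adj G u v → IsEdge G (edge u v)
  isEdge-edge {u} {v} e with Fin.<-cmp u v
  ... | tri< u<v _ _ = u<v , e
  ... | tri≈ _ eq _  = contradiction e (adj-irrefl G eq)
  ... | tri> _ _ v<u = v<u , adj-sym G e

  -- A walk of the line graph described inside `G`, as turns from `va` to `vb` at a common end `v`.
  -- Colours are plain numbers, so a trail is not tied to the number of colours currently available.
  data Trail (γ : TurnColouring) : Fin n × Fin n → Fin n × Fin n → List ℕ → Set where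
    []   : ∀ {e} → Trail γ e e []
    turn : ∀ {v a b f cs} → Adj G v a → Adj G v b → a ≢ b →
           Trail γ (edge v b) f cs → Trail γ (edge v a) f (γ v a b ∷ cs)

  _++ᵗ_ : ∀ {γ e f g cs ds} → Trail γ e f cs → Trail γ f g ds → Trail γ e g (cs ++ ds)
  []                ++ᵗ q = q
  turn va vb a≢b p ++ᵗ q = turn va vb a≢b (p ++ᵗ q)

  reverse-trail : ∀ {γ} → SymmetricTurns γ → ∀ {e f cs} → Trail γ e f cs → Trail γ f e (reverse cs)
  reverse-trail γ-sym [] = []
  reverse-trail {γ} γ-sym (turn {v} {a} {b} {f} {cs} va vb a≢b p) =
    subst (Trail γ f (edge v a)) (sym (unfold-reverse (γ v a b) cs))
      (reverse-trail γ-sym p ++ᵗ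
       subst (λ c → Trail γ (edge v b) (edge v a) [ c ]) (γ-sym v b a) (turn vb va (≢-sym a≢b) []))

  record Joined (γ : TurnColouring) (k : ℕ) (e f : Fin n × Fin n) : Set where
    constructor joined
    field
      {palette} : List ℕ
      trail     : Trail γ e f palette
      rainbow   : Unique palette
      bounded   : All (_< k) palette

  joined-sym : ∀ {γ} → SymmetricTurns γ → ∀ {k e f} → Joined γ k e f → Joined γ k f e
  joined-sym γ-sym (joined {cs} p unique bounded) = joined (reverse-trail γ-sym p)
    (Permutation.Unique-resp-↭ (setoid ℕ) (↭⇒↭ₛ (↭-sym (↭-reverse cs))) unique)
    (All-resp-↭ (↭-sym (↭-reverse cs)) bounded)

  joined-mono : ∀ {γ k l e f} → k ≤ l → Joined γ k e f → Joined γ l e f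
  joined-mono k≤l (joined p unique bounded) = joined p unique (All.map (λ c<k → ℕ.<-≤-trans c<k k≤l) bounded)

  joined-turn : ∀ {γ k v a b} → Adj G v a → Adj G v b → (a ≢ b → γ v a b < k) →
    Joined γ k (edge v a) (edge v b)
  joined-turn {a = a} {b} va vb bound with a Fin.≟ b
  ... | yes refl = joined [] [] []
  ... | no a≢b   = joined (turn va vb a≢b []) ([] ∷ []) (bound a≢b ∷ [])

  -- All earlier colours lie below `k`, so a last turn of colour exactly `k` repeats none of them.
  joined-snoc : ∀ {γ k e v a b} → Joined γ k e (edge v a) → Adj G v a → Adj G v b → a ≢ b →
    γ v a b ≡ k → Joined γ (suc k) e (edge v b)
  joined-snoc {γ} {k} {e} {v} {a} {b} (joined {cs} p unique bounded) va vb a≢b eq = joined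
    (p ++ᵗ turn va vb a≢b [])
    (Unique.++⁺ unique ([] ∷ []) λ { (c∈ , here refl) → ℕ.<-irrefl eq (All.lookup bounded c∈) })
    (All.++⁺ (All.map ℕ.m<n⇒m<1+n bounded) (s≤s (ℕ.≤-reflexive eq) ∷ []))

  Linked : TurnColouring → ℕ → List (Fin n) → Set
  Linked γ k W = ∀ {u a v b} → u ∈ W → Adj G u a → v ∈ W → Adj G v b → Joined γ k (edge u a) (edge v b)

  -- The induction step shared by leaves and triangles: `N` holds the new vertices, all adjacent to
  -- the reached vertex `p`. The hypothesis `gate` promises `k < l` only where there is a second
  -- edge to turn to, so a pendant vertex costs no colour.
  module _ {γ : TurnColouring} (γ-sym : SymmetricTurns γ) {k l : ℕ} (k≤l : k ≤ l)
    {W N : List (Fin n)} (linked : Linked γ k W) {p : Fin n} (p∈W : p ∈ W)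
    (child : ∀ {v} → v ∈ N → Adj G v p)
    (gate : ∀ {v a} → v ∈ N → Adj G v a → a ≢ p → γ v p a ≡ k × k < l)
    (new : ∀ {u a v b} → u ∈ N → Adj G u a → a ≢ p → v ∈ N → Adj G v b → b ≢ p →
           Joined γ l (edge u a) (edge v b))
    where

    private
      -- The edge `pv` is incident with the old vertex `p`, hence joined to every old edge by
      -- colours below `k`; one more turn at `v`, of the fresh colour `k`, reaches `vb`.
      enter : ∀ {u a v b} → u ∈ W → Adj G u a → v ∈ N → Adj G v b → Joined γ l (edge u a) (edge v b)
      enter {v = v} {b} u∈W ua v∈N vb 
        with b Fin.≟ p | subst (Joined γ k _) (edge-comm p v) (linked u∈W ua p∈W (adj-sym G (child v∈N)))
      ... | yes refl | to-parent = joined-mono k≤l to-parent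
      ... | no b≢p   | to-parent =
        let eq , k<l = gate v∈N vb b≢p in
        joined-mono k<l (joined-snoc to-parent (child v∈N) vb (≢-sym b≢p) eq)

    linked-++ : Linked γ l (N ++ W)
    linked-++ {u} {a} {v} {b} u∈ ua v∈ vb with Any.++⁻ N u∈ | Any.++⁻ N v∈
    ... | inj₂ u∈W | inj₂ v∈W = joined-mono k≤l (linked u∈W ua v∈W vb)
    ... | inj₂ u∈W | inj₁ v∈N = enter u∈W ua v∈N vb
    ... | inj₁ u∈N | inj₂ v∈W = joined-sym γ-sym (enter v∈W vb u∈N ua)
    ... | inj₁ u∈N | inj₁ v∈N with a Fin.≟ p | b Fin.≟ p
    -- An edge from a new vertex to `p` is treated as an edge at the old vertex `p`.
    ...   | yes refl | _        = subst (λ e → Joined γ l e _) (edge-comm a u) (enter p∈W (adj-sym G ua) v∈N vb)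
    ...   | no _     | yes refl = joined-sym γ-sym
      (subst (λ e → Joined γ l e _) (edge-comm b v) (enter p∈W (adj-sym G vb) u∈N ua))
    ...   | no a≢p   | no b≢p   = new u∈N ua a≢p v∈N vb b≢p

  two-neighbours⇒degree : ∀ {v a b} → Adj G v a → Adj G v b → a ≢ b → 2 ≤ degree G v
  two-neighbours⇒degree {v} va vb a≢b = unique-length ((a≢b ∷ []) ∷ [] ∷ [])
    λ { (here refl) → ∈-filter⁺ (adj? G v) (∈-allFin _) va
      ; (there (here refl)) → ∈-filter⁺ (adj? G v) (∈-allFin _) vb }

  -- The tests look for the common end of the two pairs; the final branch is the case where `v` and
  -- `y` coincide. The value matters for adjacent edges only.
  turnColour : TurnColouring → Fin n × Fin n → Fin n × Fin n → ℕ
  turnColour γ (u , v) (x , y) =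
    if does (u Fin.≟ x) then γ u v y else
    if does (u Fin.≟ y) then γ u v x else
    if does (v Fin.≟ x) then γ v u y else γ v u x

  -- Since `a` and `b` differ, `v` is the only common end, and no test of `turnColour` succeeds at a
  -- wrong vertex.
  turnColour-edge : ∀ γ {v a b} → Adj G v a → Adj G v b → a ≢ b → turnColour γ (edge v a) (edge v b) ≡ γ v a b
  turnColour-edge γ {v} {a} {b} va vb a≢b with Fin.<-cmp v a | Fin.<-cmp v b
  ... | tri≈ _ v≡a _ | _ = contradiction va (adj-irrefl G v≡a)
  ... | tri< _ _ _ | tri≈ _ v≡b _ = contradiction vb (adj-irrefl G v≡b)
  ... | tri> _ _ _ | tri≈ _ v≡b _ = contradiction vb (adj-irrefl G v≡b)
  ... | tri< _ _ _ | tri< _ _ _ rewrite dec-true (v Fin.≟ v) refl = refl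
  ... | tri< _ _ _ | tri> _ v≢b _ rewrite dec-false (v Fin.≟ b) v≢b | dec-true (v Fin.≟ v) refl = refl
  ... | tri> _ v≢a _ | tri< _ _ _
    rewrite dec-false (a Fin.≟ v) (≢-sym v≢a) | dec-false (a Fin.≟ b) a≢b | dec-true (v Fin.≟ v) refl = refl
  ... | tri> _ v≢a _ | tri> _ v≢b _
    rewrite dec-false (a Fin.≟ b) a≢b | dec-false (a Fin.≟ v) (≢-sym v≢a) | dec-false (v Fin.≟ b) v≢b = refl

  incident : ∀ {x e} → IsEdge G e → x ∈ᵉ e → ∃[ a ] (Adj G x a × e ≡ edge x a)
  incident {e = u , v} (u<v , uv) (inj₁ refl) = v , uv , sym (edge-< u<v)
  incident {e = u , v} (u<v , uv) (inj₂ refl) = u , adj-sym G uv , sym (edge-> u<v)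

  common-endpoint : ∀ {e f} → Adj (L G) e f →
    ∃[ x ] ∃[ a ] ∃[ b ] (Adj G x a × Adj G x b × a ≢ b × e ≡ edge x a × f ≡ edge x b)
  common-endpoint (e-edge , f-edge , e≢f , x , x∈e , x∈f) =
    let a , xa , e≡ = incident e-edge x∈e
        b , xb , f≡ = incident f-edge x∈f
    in x , a , b , xa , xb , (λ a≡b → e≢f (trans e≡ (trans (cong (edge x) a≡b) (sym f≡)))) , e≡ , f≡

  module _ {γ : TurnColouring} (γ-sym : SymmetricTurns γ) {k : ℕ}
    (bound : ∀ {v a b} → Adj G v a → Adj G v b → a ≢ b → γ v a b < k) where

    private
      turnColour-bound : ∀ {e f} → Adj (L G) e f → turnColour γ e f < k
      turnColour-bound e~f with common-endpoint e~f
      ... | x , a , b , xa , xb , a≢b , refl , refl =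
        subst (_< k) (sym (turnColour-edge γ xa xb a≢b)) (bound xa xb a≢b)

      turnColour-sym : ∀ {e f} → Adj (L G) e f → turnColour γ e f ≡ turnColour γ f e
      turnColour-sym e~f with common-endpoint e~f
      ... | x , a , b , xa , xb , a≢b , refl , refl =
        trans (turnColour-edge γ xa xb a≢b) (trans (γ-sym x a b) (sym (turnColour-edge γ xb xa (≢-sym a≢b))))

    lineColouring : EdgeColouring (L G) k
    lineColouring = record
      { colour     = λ e f e~f → fromℕ< (turnColour-bound e~f)
      ; colour-sym = λ e f e~f f~e → Fin.fromℕ<-cong _ _
          (recompute (turnColour γ e f ℕ.≟ turnColour γ f e) (turnColour-sym e~f))
          (turnColour-bound e~f) (turnColour-bound f~e)
      }

    trail⇒walk : ∀ {e f cs} → Vertex (L G) e → Trail γ e f cs →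
      Σ[ p ∈ Walk (L G) e f ] map toℕ (colours lineColouring p) ≡ cs
    trail⇒walk e∈ [] = stop e∈ , refl
    trail⇒walk e∈ (turn {v} {a} {b} va vb a≢b p) =
      let q , eq = trail⇒walk (isEdge-edge vb) p in
      step (isEdge-edge va , isEdge-edge vb , a≢b ∘ edge-injectiveʳ , v , ∈ᵉ-edge v a , ∈ᵉ-edge v b) q ,
      cong₂ _∷_ (trans (Fin.toℕ-fromℕ< _) (turnColour-edge γ va vb a≢b)) eq

    linked⇒rainbowConnected : ∀ {W} → (∀ {v} → Vertex G v → v ∈ W) → Linked γ k W → RainbowColourable (L G) k
    linked⇒rainbowConnected covers linked = lineColouring , λ { (a , b) (c , d) e∈@(a<b , ab) f∈@(c<d , cd) →
      let joined p unique _ = subst₂ (Joined γ k) (edge-< a<b) (edge-< c<d)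
            (linked (covers (adj-vertex G ab)) ab (covers (adj-vertex G cd)) cd)
          q , eq = trail⇒walk e∈ p
      in rainbow-walk⇒path (finite-≟ (λ (u , v) → combine u v) (remQuot n)
           λ (u , v) → Fin.remQuot-combine u v) lineColouring q
           (Unique.map⁻ (subst Unique (sym eq) unique)) }

-- Growing the reached set

module Growth {n} {G : Graph (Fin n)} {t} {T : Fin t → Graph (Fin n)} (F : ForestOfTriangles G T) where
  open ForestOfTriangles F
  open import Data.List.Membership.DecPropositional (Fin._≟_ {n}) using (_∈?_)
  open import Data.List.Membership.DecPropositional (Fin._≟_ {t}) using () renaming (_∈?_ to _∈ᵗ?_)

  Branching : Pred (Fin n) 0ℓ
  Branching v = 2 ≤ degree G v

  branching? : Decidable Branching
  branching? v = 2 ≤? degree G v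

  used : List (Fin t) → Graph (Fin n)
  used S = selected (_∈ᵗ? S) T

  -- The invariant of the growth. `count` is the account: every reached vertex of degree at least 2
  -- pays for one colour or one absorbed triangle. `to-hub` ties together, by absorbed triangles,
  -- all reached vertices on triangles still to come; the hub is exempt because it need not lie on
  -- an absorbed triangle.
  record State : Set where
    field
      reached        : List (Fin n)
      reached-unique : Unique reached
      absorbed       : List (Fin t)
      γ              : TurnColouring {n}
      γ-sym          : SymmetricTurns γ
      k              : ℕ
      γ-bound        : ∀ {v a b} → v ∈ reached → Adj G v a → Adj G v b → a ≢ b → γ v a b < k
      -- Stated for every extension of γ, so that it survives later extensions.
      linked         : ∀ {δ} → SymmetricTurns δ → (∀ {v} → v ∈ reached → δ v ≡ γ v) → Linked G δ k reached
      count          : k + length absorbed ≡ length (filter branching? reached)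
      hub            : Fin n
      hub∈           : hub ∈ reached
      hub-vertex     : Vertex G hub
      to-hub         : ∀ {v i} → v ∈ reached → i ∉ absorbed → Vertex (T i) v → v ≢ hub → Walk (used absorbed) v hub

    -- Two distinct reached corners of `T i` would both be tied to the hub, hence joined by
    -- triangles other than `T i`, against `corners-separated`.
    separated : ∀ {i u v} → i ∉ absorbed → Vertex (T i) u → Vertex (T i) v → u ∈ reached → v ∈ reached → u ≡ v
    separated {i} {u} {v} i∉ ui vi u∈ v∈ = by-cases
      where
      apart : u ≢ v → ¬ Walk (used absorbed) u v
      apart u≢v p = corners-separated F ui vi u≢v
        (map-walk (selected-mono (_∈ᵗ? absorbed) (λ j → ¬? (j Fin.≟ i)) T λ { j∈ refl → i∉ j∈ }) p)

      by-cases : u ≡ v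
      by-cases with u Fin.≟ v | u Fin.≟ hub | v Fin.≟ hub
      ... | yes u≡v | _        | _        = u≡v
      ... | no u≢v  | yes refl | yes refl = contradiction refl u≢v
      ... | no u≢v  | yes refl | no v≢h   = contradiction (reverse-walk (to-hub v∈ i∉ vi v≢h)) (apart u≢v)
      ... | no u≢v  | no u≢h   | yes refl = contradiction (to-hub u∈ i∉ ui u≢h) (apart u≢v)
      ... | no u≢v  | no u≢h   | no v≢h   =
        contradiction (to-hub u∈ i∉ ui u≢h ++ʷ reverse-walk (to-hub v∈ i∉ vi v≢h)) (apart u≢v)

  open State

  Larger : State → Set
  Larger s = ∃[ s′ ] (length (reached s) < length (reached s′))

  initial : ∀ {r} → Vertex G r → State
  initial {r} r∈G = record
    { reached        = [ r ]
    ; reached-unique = [] ∷ []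
    ; absorbed       = []
    ; γ              = λ _ _ _ → 0
    ; γ-sym          = λ _ _ _ → refl
    -- One colour if the root has degree at least 2, and none otherwise.
    ; k              = length (filter branching? [ r ])
    ; γ-bound        = bound
    ; linked         = λ { _ agree (here refl) ra (here refl) rb →
                           joined-turn G ra rb λ a≢b → subst (_< _) (sym (cong (λ f → f _ _) (agree (here refl))))
                             (bound (here refl) ra rb a≢b) }
    ; count          = ℕ.+-identityʳ _
    ; hub            = r
    ; hub∈           = here refl
    ; hub-vertex     = r∈G
    ; to-hub         = λ { (here refl) _ _ r≢r → contradiction refl r≢r }
    }
    where
    bound : ∀ {v a b} → v ∈ [ r ] → Adj G v a → Adj G v b → a ≢ b → 0 < length (filter branching? [ r ])
    bound (here refl) ra rb a≢b = ℕ.≤-reflexive (sym (cong length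
      (filter-accept branching? (two-neighbours⇒degree G ra rb a≢b))))

  -- Adding a single vertex

  module _ (s : State) {p x : Fin n} (p∈ : p ∈ reached s) (x∉ : x ∉ reached s) (px : Adj G p x)
    (detached : ∀ {i v} → i ∉ absorbed s → v ∈ reached s → ¬ Vertex (T i) v) where

    private
      γ′ : TurnColouring
      γ′ = override x (λ _ _ → k s) (γ s)

      leaf : ∀ l → k s ≤ l → (∀ {a b} → Adj G x a → Adj G x b → a ≢ b → k s < l) →
             l + length (absorbed s) ≡ length (filter branching? (x ∷ reached s)) → State
      leaf l k≤l k<l count′ = record
        { reached        = x ∷ reached s
        ; reached-unique = unique-∷ x∉ (reached-unique s)
        ; absorbed       = absorbed s
        ; γ              = γ′
        ; γ-sym          = override-sym x (λ _ _ → refl) (γ-sym s)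
        ; k              = l
        ; γ-bound        = bound
        ; linked         = λ δ-sym agree → linked-++ G δ-sym k≤l
            (linked s δ-sym λ {v} v∈ →
              trans (agree (there v∈)) (override-off (λ _ _ → k s) (γ s) λ { refl → x∉ v∈ }))
            p∈
            (λ { (here refl) → adj-sym G px })
            (λ { (here refl) xa a≢p → cong (λ f → f _ _)
                   (trans (agree (here refl)) (override-at x (λ _ _ → k s) (γ s))) ,
                 k<l xa (adj-sym G px) a≢p })
            (λ { (here refl) xa _ (here refl) xb _ → joined-turn G xa xb λ a≢b →
                   subst (_< l) (sym (cong (λ f → f _ _) (agree (here refl)))) (bound (here refl) xa xb a≢b) })
        ; count          = count′
        -- By `detached`, no triangle still to come meets an old vertex, so `to-hub` is vacuous
        -- there and the hub can move to `x`.
        ; hub            = x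
        ; hub∈           = here refl
        ; hub-vertex     = adj-vertex G (adj-sym G px)
        ; to-hub         = λ { (here refl) _ _ x≢x → contradiction refl x≢x
                             ; (there v∈) i∉ vi _ → contradiction vi (detached i∉ v∈) }
        }
        where
        bound : ∀ {v a b} → v ∈ x ∷ reached s → Adj G v a → Adj G v b → a ≢ b → γ′ v a b < l
        bound (here refl) xa xb a≢b =
          subst (_< l) (sym (cong (λ f → f _ _) (override-at x (λ _ _ → k s) (γ s)))) (k<l xa xb a≢b)
        bound (there v∈) va vb a≢b =
          subst (_< l) (sym (cong (λ f → f _ _) (override-off (λ _ _ → k s) (γ s) λ { refl → x∉ v∈ })))
            (ℕ.<-≤-trans (γ-bound s v∈ va vb a≢b) k≤l)

    add-leaf : Larger s
    add-leaf with branching? x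
    ... | yes x-branching = leaf (suc (k s)) (ℕ.n≤1+n _) (λ _ _ _ → ℕ.≤-refl)
            (trans (cong suc (count s)) (sym (cong length (filter-accept branching? x-branching)))) , ℕ.≤-refl
    -- There is no turn at a vertex of degree at most 1, so no colour is spent.
    ... | no ¬branching = leaf (k s) ℕ.≤-refl
            (λ xa xb a≢b → contradiction (two-neighbours⇒degree G xa xb a≢b) ¬branching)
            (trans (count s) (sym (cong length (filter-reject branching? ¬branching)))) , ℕ.≤-refl

  -- Adding a triangle

  module _ (s : State) {i : Fin t} (i∉ : i ∉ absorbed s) {p x y : Fin n} (p∈ : p ∈ reached s)
    (px : Adj (T i) p x) (py : Adj (T i) p y) (xy : Adj (T i) x y) where

    private
      x≢y : x ≢ y
      x≢y eq = adj-irrefl (T i) eq xy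
      p≢x : p ≢ x
      p≢x eq = adj-irrefl (T i) eq px
      p≢y : p ≢ y
      p≢y eq = adj-irrefl (T i) eq py

      Gpx : Adj G p x
      Gpx = adj-⊑ (subgraph i) px
      Gpy : Adj G p y
      Gpy = adj-⊑ (subgraph i) py
      Gxy : Adj G x y
      Gxy = adj-⊑ (subgraph i) xy

      x∉ : x ∉ reached s
      x∉ x∈ = p≢x (separated s i∉ (adj-vertex (T i) px) (adj-vertex (T i) xy) p∈ x∈)
      y∉ : y ∉ reached s
      y∉ y∈ = p≢y (separated s i∉ (adj-vertex (T i) py) (adj-vertex (T i) (adj-sym (T i) py)) p∈ y∈)

      -- The turns at x between xy and an edge other than xp reuse an old colour;
      -- an edge at x and an edge at y are then joined through xy by two colours.
      exceptional : Fin n → Fin n → Bool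
      exceptional a b = does (b Fin.≟ y) ∧ not (does (a Fin.≟ p))

      xTurn : Fin n → Fin n → ℕ
      xTurn a b = if exceptional a b ∨ exceptional b a then γ s p x y else k s

      xTurn-sym : ∀ a b → xTurn a b ≡ xTurn b a
      xTurn-sym a b = cong (if_then γ s p x y else k s) (Bool.∨-comm (exceptional a b) (exceptional b a))

      -- These turns let old edges reach the edges at `x`, so they must keep the fresh colour.
      xTurn-from-p : ∀ b → b ≢ p → xTurn p b ≡ k s
      xTurn-from-p b b≢p
        rewrite dec-true (p Fin.≟ p) refl | dec-false (p Fin.≟ y) p≢y | Bool.∧-zeroʳ (does (b Fin.≟ y)) = refl

      xTurn-to-y : ∀ a → a ≢ p → xTurn a y ≡ γ s p x y
      xTurn-to-y a a≢p rewrite dec-true (y Fin.≟ y) refl | dec-false (a Fin.≟ p) a≢p = refl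

      -- The turn at `p` between the two triangle edges supplies an old colour, so at least one
      -- exists.
      old-colour : γ s p x y < k s
      old-colour = γ-bound s p∈ Gpx Gpy x≢y

      xTurn-bound : ∀ a b → xTurn a b < suc (k s)
      xTurn-bound a b with exceptional a b ∨ exceptional b a
      ... | true  = ℕ.m<n⇒m<1+n old-colour
      ... | false = ℕ.≤-refl

      yTurn : Fin n → Fin n → ℕ
      yTurn _ _ = k s

      γ′ : TurnColouring
      γ′ = override x xTurn (override y yTurn (γ s))

      γ′-x : γ′ x ≡ xTurn
      γ′-x = override-at x xTurn (override y yTurn (γ s))

      γ′-y : γ′ y ≡ yTurn
      γ′-y = trans (override-off xTurn (override y yTurn (γ s)) (≢-sym x≢y)) (override-at y yTurn (γ s))

      γ′-old : ∀ {v} → v ∈ reached s → γ′ v ≡ γ s v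
      γ′-old {v} v∈ = trans
        (override-off {x = x} {v} xTurn (override y yTurn (γ s)) λ { refl → x∉ v∈ })
        (override-off {x = y} {v} yTurn (γ s) λ { refl → y∉ v∈ })

      new : List (Fin n)
      new = x ∷ y ∷ []

      bound : ∀ {v a b} → v ∈ new ++ reached s → Adj G v a → Adj G v b → a ≢ b → γ′ v a b < suc (k s)
      bound {a = a} {b} (here refl) _ _ _ =
        subst (_< suc (k s)) (sym (cong (λ f → f a b) γ′-x)) (xTurn-bound a b)
      bound {a = a} {b} (there (here refl)) _ _ _ =
        subst (_< suc (k s)) (sym (cong (λ f → f a b) γ′-y)) ℕ.≤-refl
      bound {a = a} {b} (there (there v∈)) va vb a≢b =
        subst (_< suc (k s)) (sym (cong (λ f → f a b) (γ′-old v∈))) (ℕ.m<n⇒m<1+n (γ-bound s v∈ va vb a≢b))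

      module _ {δ} (δ-sym : SymmetricTurns δ) (agree : ∀ {v} → v ∈ new ++ reached s → δ v ≡ γ′ v) where

        δ-x : ∀ a b → δ x a b ≡ xTurn a b
        δ-x a b = cong (λ f → f a b) (trans (agree (here refl)) γ′-x)

        δ-y : ∀ a b → δ y a b ≡ k s
        δ-y a b = cong (λ f → f a b) (trans (agree (there (here refl))) γ′-y)

        same : ∀ {v a b} → v ∈ new → Adj G v a → Adj G v b → Joined G δ (suc (k s)) (edge v a) (edge v b)
        same {a = a} {b} v∈ va vb = joined-turn G va vb λ a≢b →
          subst (_< suc (k s)) (sym (cong (λ f → f a b) (agree (Any.++⁺ˡ v∈)))) (bound (Any.++⁺ˡ v∈) va vb a≢b)

        -- From `xa` turn at `x` to `xy` in the old colour, then at `y` to `yb` in the fresh one. If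
        -- one of the edges is `xy` itself, both meet at one vertex and at most one turn is made.
        across : ∀ {a b} → Adj G x a → a ≢ p → Adj G y b → b ≢ p →
          Joined G δ (suc (k s)) (edge x a) (edge y b)
        across {a} {b} xa a≢p yb b≢p with a Fin.≟ y | b Fin.≟ x
        ... | yes refl | _ = subst (λ e → Joined G δ _ e _) (edge-comm y x)
                               (same (there (here refl)) (adj-sym G Gxy) yb)
        ... | no _ | yes refl = subst (Joined G δ _ _) (edge-comm x y) (same (here refl) xa Gxy)
        ... | no a≢y | no b≢x = joined-snoc G
          (subst (Joined G δ (k s) _) (edge-comm x y) (joined-turn G xa Gxy λ _ →
            subst (_< k s) (sym (trans (δ-x a y) (xTurn-to-y a a≢p))) old-colour))
          (adj-sym G Gxy) yb (≢-sym b≢x) (δ-y x b)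

        linked′ : Linked G δ (suc (k s)) (new ++ reached s)
        linked′ = linked-++ G δ-sym (ℕ.n≤1+n _)
          (linked s δ-sym λ v∈ → trans (agree (there (there v∈))) (γ′-old v∈))
          p∈
          (λ { (here refl) → adj-sym G Gpx ; (there (here refl)) → adj-sym G Gpy })
          (λ { {a = a} (here refl) _ a≢p → trans (δ-x p a) (xTurn-from-p a a≢p) , ℕ.≤-refl
             ; {a = a} (there (here refl)) _ _ → δ-y p a , ℕ.≤-refl })
          (λ { (here refl) xa _ (here refl) xb _ → same (here refl) xa xb
             ; (here refl) xa a≢p (there (here refl)) yb b≢p → across xa a≢p yb b≢p
             ; (there (here refl)) ya a≢p (here refl) xb b≢p → joined-sym G δ-sym (across xb b≢p ya a≢p)
             ; (there (here refl)) ya _ (there (here refl)) yb _ → same (there (here refl)) ya yb })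

      -- Both `x` and `y` have two neighbours inside the triangle, so two vertices are gained for
      -- the account: one pays for the new colour, the other for the triangle.
      count′ : suc (k s) + suc (length (absorbed s)) ≡ length (filter branching? (new ++ reached s))
      count′ = trans (cong suc (trans (ℕ.+-suc (k s) _) (cong suc (count s))))
        (sym (cong length (trans (filter-accept branching? (two-neighbours⇒degree G (adj-sym G Gpx) Gxy p≢y))
          (cong (x ∷_) (filter-accept branching?
            (two-neighbours⇒degree G (adj-sym G Gpy) (adj-sym G Gxy) p≢x))))))

      lift : ∀ {u v} → Walk (used (absorbed s)) u v → Walk (used (i ∷ absorbed s)) u v
      lift = map-walk (selected-mono (_∈ᵗ? absorbed s) (_∈ᵗ? (i ∷ absorbed s)) T there)

      through-p : ∀ {v} → Adj (T i) p v → Walk (used (i ∷ absorbed s)) v (hub s)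
      through-p pv with p Fin.≟ hub s
      ... | yes refl = edge-walk {G = used _} (i , here refl , adj-sym (T i) pv)
      ... | no p≢h   = step (i , here refl , adj-sym (T i) pv) (lift (to-hub s p∈ i∉ (adj-vertex (T i) pv) p≢h))

    add-triangle : Larger s
    add-triangle = record
      { reached        = new ++ reached s
      ; reached-unique = unique-∷ (λ { (here eq) → x≢y eq ; (there x∈) → x∉ x∈ })
                           (unique-∷ y∉ (reached-unique s))
      ; absorbed       = i ∷ absorbed s
      ; γ              = γ′
      ; γ-sym          = override-sym x xTurn-sym (override-sym y (λ _ _ → refl) (γ-sym s))
      ; k              = suc (k s)
      ; γ-bound        = bound
      ; linked         = linked′
      ; count          = count′
      ; hub            = hub s
      ; hub∈           = there (there (hub∈ s))
      ; hub-vertex     = hub-vertex s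
      ; to-hub         = λ { (here refl) _ _ _ → through-p px
                           ; (there (here refl)) _ _ _ → through-p py
                           ; (there (there v∈)) j∉ vj v≢h → lift (to-hub s v∈ (j∉ ∘ there) vj v≢h) }
      } , ℕ.n≤1+n _

  -- Termination and the upper bound

  Complete : State → Set
  Complete s = (∀ {v} → Vertex G v → v ∈ reached s) × (∀ i → i ∈ absorbed s)

  module _ (G-connected : Connected G) where

    -- Triangles take precedence: a single vertex is added only when no unabsorbed triangle meets
    -- the reached set, which is what `detached` demands. If neither step applies, the reached set
    -- is closed under adjacency and contains every vertex.
    grow : ∀ s → Complete s ⊎ Larger s
    grow s with Fin.any? (λ i → Fin.any? λ p → ¬? (i ∈ᵗ? absorbed s) ×-dec p ∈? reached s ×-dec vertex? (T i) p)
    ... | yes (i , p , i∉ , p∈ , pi) =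
      let x , y , px , py , xy , _ = Triangle.rotate (triangle i) pi in inj₂ (add-triangle s i∉ p∈ px py xy)
    ... | no none with Fin.any? (λ p → Fin.any? λ x → p ∈? reached s ×-dec ¬? (x ∈? reached s) ×-dec adj? G p x)
    ...   | yes (p , x , p∈ , x∉ , px) =
      inj₂ (add-leaf s p∈ x∉ px λ {i} {v} i∉ v∈ vi → none (i , v , i∉ , v∈ , vi))
    ...   | no closed = inj₁ (covers , all-absorbed)
      where
      follow : ∀ {u v} → Walk G u v → u ∈ reached s → v ∈ reached s
      follow (stop _) u∈ = u∈
      follow (step {v = w} e p) u∈ with w ∈? reached s
      ... | yes w∈ = follow p w∈
      ... | no w∉  = contradiction (_ , w , u∈ , w∉ , e) closed

      covers : ∀ {v} → Vertex G v → v ∈ reached s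
      covers {v} v∈G = follow (proj₂ G-connected (hub s) v (hub-vertex s) v∈G) (hub∈ s)

      all-absorbed : ∀ i → i ∈ absorbed s
      all-absorbed i with i ∈ᵗ? absorbed s
      ... | yes i∈ = i∈
      ... | no i∉  = contradiction
        (i , Triangle.a (triangle i) , i∉ ,
         covers (adj-vertex G (adj-⊑ (subgraph i) (Triangle.ab (triangle i)))) ,
         adj-vertex (T i) (Triangle.ab (triangle i))) none

    -- Each step lengthens the duplicate-free list `reached`, whose length cannot exceed `n`; `m`
    -- bounds the room left.
    run : ∀ m s → n ≤ m + length (reached s) → ∃ Complete
    run m s large with grow s
    ... | inj₁ complete = s , complete
    run zero s large | inj₂ (s′ , larger) =
      contradiction (ℕ.<-≤-trans larger (unique-Fin-length (reached-unique s′))) (ℕ.≤⇒≯ large)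
    run (suc m) s large | inj₂ (s′ , larger) = run m s′
      (ℕ.≤-trans large (ℕ.≤-trans (ℕ.≤-reflexive (sym (ℕ.+-suc m _))) (ℕ.+-monoʳ-≤ m larger)))

    colour-bound : ∃[ k ] (HasRC (L G) k × k + t ≤ n₂ G)
    colour-bound =
      let r , r∈G = proj₁ G-connected
          s , covers , all-absorbed = run n (initial r∈G) (ℕ.m≤m+n n _)
          m , rc , m≤k = hasRC-bound (λ (u , v) → combine u v) (remQuot n)
            (λ (u , v) → Fin.remQuot-combine u v)
            (linked⇒rainbowConnected G (γ-sym s) (λ va → γ-bound s (covers (adj-vertex G va)) va)
              covers (linked s (γ-sym s) λ _ → refl))
      in m , rc , (begin
        m + t                                     ≤⟨ ℕ.+-mono-≤ m≤k (t≤absorbed s all-absorbed) ⟩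
        k s + length (absorbed s)                 ≡⟨ count s ⟩
        length (filter branching? (reached s))    ≤⟨ unique-length
          (Unique.filter⁺ branching? (reached-unique s))
          (λ v∈ → ∈-filter⁺ branching? (∈-allFin _) (proj₂ (∈-filter⁻ branching? {xs = reached s} v∈))) ⟩
        n₂ G                                      ∎)
      where
      open ℕ.≤-Reasoning
      t≤absorbed : ∀ s → (∀ i → i ∈ absorbed s) → t ≤ length (absorbed s)
      t≤absorbed s all-absorbed = subst (_≤ length (absorbed s)) (length-tabulate {n = t} (λ i → i))
        (unique-length (Unique.allFin⁺ t) λ {i} _ → all-absorbed i)

-- Sharpness

-- This is u/3 rounded up: 0 is alone in row 0, and 3i+1, 3i+2, 3i+3 make up row i+1.
row : ℕ → ℕ
row 0                   = 0
row 1                   = 1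
row 2                   = 1
row (suc (suc (suc u))) = suc (row u)

row-≤-suc : ∀ u → row u ≤ row (suc u)
row-≤-suc 0                   = z≤n
row-≤-suc 1                   = s≤s z≤n
row-≤-suc 2                   = s≤s z≤n
row-≤-suc (suc (suc (suc u))) = s≤s (row-≤-suc u)

-- Row boundaries are three numbers apart, so two steps cross at most one.
row-2+ : ∀ u → row (2 + u) ≤ suc (row u)
row-2+ 0                   = s≤s z≤n
row-2+ 1                   = s≤s z≤n
row-2+ 2                   = s≤s (s≤s z≤n)
row-2+ (suc (suc (suc u))) = s≤s (row-2+ u)

row-suc-≤ : ∀ u → row (suc u) ≤ suc (row u)
row-suc-≤ u = ℕ.≤-trans (row-≤-suc (suc u)) (row-2+ u)

row≡0 : ∀ u → row u ≡ 0 → u ≡ 0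
row≡0 0                   _  = refl
row≡0 1                   ()
row≡0 2                   ()
row≡0 (suc (suc (suc _))) ()

row-*3 : ∀ i → row (i * 3) ≡ i
row-*3 zero    = refl
row-*3 (suc i) = cong suc (row-*3 i)

row-1+*3 : ∀ i → row (1 + i * 3) ≡ suc i
row-1+*3 zero    = refl
row-1+*3 (suc i) = cong suc (row-1+*3 i)

row-2+*3 : ∀ i → row (2 + i * 3) ≡ suc i
row-2+*3 zero    = refl
row-2+*3 (suc i) = cong suc (row-2+*3 i)

row≡suc : ∀ u i → row u ≡ suc i → u ≡ 1 + i * 3 ⊎ u ≡ 2 + i * 3 ⊎ u ≡ 3 + i * 3
row≡suc 1 zero _ = inj₁ refl
row≡suc 2 zero _ = inj₂ (inj₁ refl)
row≡suc (suc (suc (suc u))) zero eq = inj₂ (inj₂ (cong (3 +_) (row≡0 u (ℕ.suc-injective eq))))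
row≡suc (suc (suc (suc u))) (suc i) eq with row≡suc u i (ℕ.suc-injective eq)
... | inj₁ refl        = inj₁ refl
... | inj₂ (inj₁ refl) = inj₂ (inj₁ refl)
... | inj₂ (inj₂ refl) = inj₂ (inj₂ refl)

module Chain (t : ℕ) where

  V : Set
  V = Fin (2 + t * 3)

  rowᶠ : V → ℕ
  rowᶠ v = row (toℕ v)

  Near : V → V → Set
  Near u v = rowᶠ u ≡ rowᶠ v ⊎ toℕ v ≡ suc (toℕ u) ⊎ toℕ u ≡ suc (toℕ v)

  near-sym : ∀ {u v} → Near u v → Near v u
  near-sym (inj₁ eq)        = inj₁ (sym eq)
  near-sym (inj₂ (inj₁ eq)) = inj₂ (inj₂ eq)
  near-sym (inj₂ (inj₂ eq)) = inj₂ (inj₁ eq)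

  -- Row 0 and row t + 1 are single pendant vertices, each row in between is a
  -- triangle, and the last vertex of a row is joined to the first of the next.
  chain : Graph V
  chain = record
    { Vertex     = λ _ → ⊤
    ; vertex?    = λ _ → yes tt
    ; Adj        = λ u v → u ≢ v × Near u v
    ; adj?       = λ u v → ¬? (u Fin.≟ v) ×-dec
        (rowᶠ u ℕ.≟ rowᶠ v ⊎-dec (toℕ v ℕ.≟ suc (toℕ u) ⊎-dec toℕ u ℕ.≟ suc (toℕ v)))
    ; adj-sym    = λ (u≢v , near) → ≢-sym u≢v , near-sym near
    ; adj-irrefl = λ eq (u≢v , _) → u≢v eq
    ; adj-vertex = λ _ → tt
    }

  rowTriangle : Fin t → Graph V
  rowTriangle i = record
    { Vertex     = λ u → rowᶠ u ≡ suc (toℕ i)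
    ; vertex?    = λ u → rowᶠ u ℕ.≟ suc (toℕ i)
    ; Adj        = λ u v → u ≢ v × rowᶠ u ≡ suc (toℕ i) × rowᶠ v ≡ suc (toℕ i)
    ; adj?       = λ u v → ¬? (u Fin.≟ v) ×-dec rowᶠ u ℕ.≟ suc (toℕ i) ×-dec rowᶠ v ℕ.≟ suc (toℕ i)
    ; adj-sym    = λ (u≢v , ui , vi) → ≢-sym u≢v , vi , ui
    ; adj-irrefl = λ eq (u≢v , _) → u≢v eq
    ; adj-vertex = λ (_ , ui , _) → ui
    }

  rowTriangle-isTriangle : ∀ i → IsTriangle (rowTriangle i)
  rowTriangle-isTriangle i = record
    { a        = a
    ; b        = b
    ; c        = c
    ; ab       = (λ eq → distinct a≡ b≡ (λ ()) eq) , a-row , b-row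
    ; bc       = (λ eq → distinct b≡ c≡ (λ ()) eq) , b-row , c-row
    ; ca       = (λ eq → distinct c≡ a≡ (λ ()) eq) , c-row , a-row
    ; only-abc = λ {v} v-row → only (row≡suc (toℕ v) (toℕ i) v-row)
    }
    where
    3+<n : 3 + toℕ i * 3 < 2 + t * 3
    3+<n = s≤s (ℕ.m≤n⇒m≤1+n (ℕ.*-monoˡ-≤ 3 (Fin.toℕ<n i)))

    2+<n : 2 + toℕ i * 3 < 2 + t * 3
    2+<n = ℕ.<-trans ℕ.≤-refl 3+<n

    1+<n : 1 + toℕ i * 3 < 2 + t * 3
    1+<n = ℕ.<-trans ℕ.≤-refl 2+<n

    a b c : V
    a = fromℕ< 1+<n
    b = fromℕ< 2+<n
    c = fromℕ< 3+<n

    a≡ : toℕ a ≡ 1 + toℕ i * 3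
    a≡ = Fin.toℕ-fromℕ< 1+<n
    b≡ : toℕ b ≡ 2 + toℕ i * 3
    b≡ = Fin.toℕ-fromℕ< 2+<n
    c≡ : toℕ c ≡ 3 + toℕ i * 3
    c≡ = Fin.toℕ-fromℕ< 3+<n

    a-row : rowᶠ a ≡ suc (toℕ i)
    a-row = trans (cong row a≡) (row-1+*3 (toℕ i))
    b-row : rowᶠ b ≡ suc (toℕ i)
    b-row = trans (cong row b≡) (row-2+*3 (toℕ i))
    c-row : rowᶠ c ≡ suc (toℕ i)
    c-row = trans (cong row c≡) (cong suc (row-*3 (toℕ i)))

    distinct : ∀ {u v : V} {l m} → toℕ u ≡ l + toℕ i * 3 → toℕ v ≡ m + toℕ i * 3 → l ≢ m → u ≢ v
    distinct u≡ v≡ l≢m refl = l≢m (ℕ.+-cancelʳ-≡ (toℕ i * 3) _ _ (trans (sym u≡) v≡))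

    only : ∀ {v : V} → toℕ v ≡ 1 + toℕ i * 3 ⊎ toℕ v ≡ 2 + toℕ i * 3 ⊎ toℕ v ≡ 3 + toℕ i * 3 →
      v ≡ a ⊎ v ≡ b ⊎ v ≡ c
    only (inj₁ eq)        = inj₁ (Fin.toℕ-injective (trans eq (sym a≡)))
    only (inj₂ (inj₁ eq)) = inj₂ (inj₁ (Fin.toℕ-injective (trans eq (sym b≡))))
    only (inj₂ (inj₂ eq)) = inj₂ (inj₂ (Fin.toℕ-injective (trans eq (sym c≡))))

  rows : Graph V
  rows = edgeUnion rowTriangle

  same-row : ∀ {i j : Fin t} {u} → rowᶠ u ≡ suc (toℕ i) → rowᶠ u ≡ suc (toℕ j) → i ≡ j
  same-row ui uj = Fin.toℕ-injective (ℕ.suc-injective (trans (sym ui) uj))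

  rowTriangle-connected : ∀ i → Connected (rowTriangle i)
  rowTriangle-connected i = (a , adj-vertex (rowTriangle i) {v = b} ab) , joined′
    where
    open IsTriangle (rowTriangle-isTriangle i)
    joined′ : ∀ u v → rowᶠ u ≡ suc (toℕ i) → rowᶠ v ≡ suc (toℕ i) → Walk (rowTriangle i) u v
    joined′ u v ui vi with u Fin.≟ v
    ... | yes refl = stop ui
    ... | no u≢v   = edge-walk {G = rowTriangle i} (u≢v , ui , vi)

  rowTriangle-nonseparable : ∀ i → Nonseparable (rowTriangle i)
  rowTriangle-nonseparable i = rowTriangle-connected i , no-cut
    where
    no-cut : ∀ x → ¬ IsCutVertex (rowTriangle i) x
    no-cut x (_ , u , v , (ui , u≢x) , (vi , v≢x) , _ , ¬walk) with u Fin.≟ v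
    ... | yes refl = ¬walk (stop (ui , u≢x))
    ... | no u≢v   = ¬walk (edge-walk {G = rowTriangle i ─ x} ((u≢v , ui , vi) , u≢x , v≢x))

  rowTriangle-⊑ : ∀ i → rowTriangle i ⊑ rows
  rowTriangle-⊑ i = record
    { vertex-⊑ = λ {v} vi →
        let y , yi , v≢y , _ = Triangle.corner-avoiding (rowTriangle-isTriangle i) v v in y , i , v≢y , vi , yi
    ; adj-⊑    = i ,_
    }

  -- Walks in `rows` never change row, so a component lies inside one row triangle and, by
  -- maximality, equals it. A block of the component is squeezed in the same way, the row triangle
  -- being nonseparable.
  rows-forest : IsTriangleForest rows
  rows-forest C (C⊑rows , C-connected@((r , r∈C) , joined′) , C-maximal) = C-connected , blocks
    where
    i : Fin t
    i = proj₁ (proj₂ (vertex-⊑ C⊑rows r∈C))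

    r-row : rowᶠ r ≡ suc (toℕ i)
    r-row = proj₁ (proj₂ (proj₂ (proj₂ (vertex-⊑ C⊑rows r∈C))))

    walk-row : ∀ {u v} → Walk C u v → rowᶠ u ≡ rowᶠ v
    walk-row (stop _)   = refl
    walk-row (step e p) = let _ , _ , uj , vj = adj-⊑ C⊑rows e in trans (trans uj (sym vj)) (walk-row p)

    C-row : ∀ {v} → Vertex C v → rowᶠ v ≡ suc (toℕ i)
    C-row v∈C = trans (walk-row (joined′ _ r v∈C r∈C)) r-row

    C⊑row : C ⊑ rowTriangle i
    C⊑row = record
      { vertex-⊑ = C-row
      ; adj-⊑    = λ e → (λ eq → adj-irrefl C eq e) , C-row (adj-vertex C e) , C-row (adj-vertex C (adj-sym C e))
      }

    row⊑C : rowTriangle i ⊑ C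
    row⊑C = C-maximal (rowTriangle i) C⊑row (rowTriangle-⊑ i) (rowTriangle-connected i)

    blocks : ∀ B → IsBlock C B → IsTriangle B
    blocks B (B⊑C , _ , B-maximal) = record
      { a        = a
      ; b        = b
      ; c        = c
      ; ab       = adj-⊑ row⊑B ab
      ; bc       = adj-⊑ row⊑B bc
      ; ca       = adj-⊑ row⊑B ca
      ; only-abc = only-abc ∘ vertex-⊑ (⊑-trans B⊑C C⊑row)
      }
      where
      open IsTriangle (rowTriangle-isTriangle i)
      row⊑B : rowTriangle i ⊑ B
      row⊑B = B-maximal (rowTriangle i) (⊑-trans B⊑C C⊑row) row⊑C (rowTriangle-nonseparable i)

  chain-forestOfTriangles : ForestOfTriangles chain rowTriangle
  chain-forestOfTriangles = record
    { subgraph = λ i → record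
        { vertex-⊑ = λ _ → tt
        ; adj-⊑    = λ (u≢v , ui , vi) → u≢v , inj₁ (trans ui (sym vi))
        }
    ; triangle = rowTriangle-isTriangle
    ; disjoint = λ i j i≢j u v (_ , ui , _) (_ , uj , _) → i≢j (same-row {u = u} ui uj)
    ; forest   = rows-forest
    }

  chain-connected : Connected chain
  chain-connected = (zero , tt) , λ u v _ _ → to-zero u ++ʷ reverse-walk (to-zero v)
    where
    to-zero : ∀ u → Walk chain u zero
    to-zero = <-weakInduction (λ u → Walk chain u zero) (stop tt) λ u p →
      step ((λ eq → ℕ.1+n≢n (trans (cong toℕ eq) (Fin.toℕ-inject₁ u))) ,
            inj₂ (inj₂ (cong suc (sym (Fin.toℕ-inject₁ u))))) p

  -- The tight case is that of consecutive numbers `a`, `x`, `b`, which by `row-2+` do not spread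
  -- over three rows.
  neighbour-rows : ∀ {x a b} → Adj chain x a → Adj chain x b → rowᶠ b ≤ suc (rowᶠ a)
  neighbour-rows {x} {a} {b} (_ , near-a) (_ , near-b) = cases near-a near-b
    where
    b≤ : Near x b → rowᶠ b ≤ suc (rowᶠ x)
    b≤ (inj₁ eq)        = ℕ.≤-trans (ℕ.≤-reflexive (sym eq)) (ℕ.n≤1+n _)
    b≤ (inj₂ (inj₁ eq)) = subst (λ m → row m ≤ _) (sym eq) (row-suc-≤ (toℕ x))
    b≤ (inj₂ (inj₂ eq)) = ℕ.≤-trans (subst (λ m → rowᶠ b ≤ row m) (sym eq) (row-≤-suc (toℕ b))) (ℕ.n≤1+n _)

    cases : Near x a → Near x b → rowᶠ b ≤ suc (rowᶠ a)
    cases (inj₁ eq) near = subst (λ r → rowᶠ b ≤ suc r) eq (b≤ near)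
    cases (inj₂ (inj₁ eq)) near =
      ℕ.≤-trans (b≤ near) (s≤s (subst (λ m → rowᶠ x ≤ row m) (sym eq) (row-≤-suc (toℕ x))))
    cases (inj₂ (inj₂ eq)) (inj₁ eq′) =
      ℕ.≤-trans (ℕ.≤-reflexive (trans (sym eq′) (cong row eq))) (row-suc-≤ (toℕ a))
    cases (inj₂ (inj₂ eq)) (inj₂ (inj₁ eq′)) =
      subst (λ m → row m ≤ suc (rowᶠ a)) (sym (trans eq′ (cong suc eq))) (row-2+ (toℕ a))
    cases (inj₂ (inj₂ eq)) (inj₂ (inj₂ eq′)) =
      ℕ.≤-trans (ℕ.≤-reflexive (cong row (ℕ.suc-injective (trans (sym eq′) eq)))) (ℕ.n≤1+n _)

  -- A potential on the edges of the chain. In a step of the line graph the common end contributes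
  -- equally on both sides, so the potential rises by at most 1.
  level : V × V → ℕ
  level (u , v) = rowᶠ u + rowᶠ v

  level-edge : ∀ u v → level (edge u v) ≡ rowᶠ u + rowᶠ v
  level-edge u v with Fin.<-cmp u v
  ... | tri< _ _ _ = refl
  ... | tri≈ _ _ _ = refl
  ... | tri> _ _ _ = ℕ.+-comm (rowᶠ v) (rowᶠ u)

  level-adj : ∀ {e f} → Adj (L chain) e f → level f ≤ suc (level e)
  level-adj e~f with common-endpoint chain e~f
  ... | x , a , b , xa , xb , _ , refl , refl =
    subst₂ (λ l m → l ≤ suc m) (sym (level-edge x b)) (sym (level-edge x a))
      (ℕ.≤-trans (ℕ.+-monoʳ-≤ (rowᶠ x) (neighbour-rows {x} {a} {b} xa xb))
        (ℕ.≤-reflexive (ℕ.+-suc (rowᶠ x) (rowᶠ a))))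

  level-walk : ∀ {k} (χ : EdgeColouring (L chain) k) {e f} (p : Walk (L chain) e f) →
    level f ≤ length (colours χ p) + level e
  level-walk χ (stop _)   = ℕ.≤-refl
  level-walk χ (step {u = e} {v = e′} e~e′ p) = ℕ.≤-trans (level-walk χ p)
    (ℕ.≤-trans (ℕ.+-monoʳ-≤ (length (colours χ p)) (level-adj {e} {e′} e~e′))
      (ℕ.≤-reflexive (ℕ.+-suc (length (colours χ p)) (level e))))

  penultimate last : V
  penultimate = inject₁ (fromℕ (t * 3))
  last        = fromℕ (suc (t * 3))

  toℕ-penultimate : toℕ penultimate ≡ t * 3
  toℕ-penultimate = trans (Fin.toℕ-inject₁ _) (Fin.toℕ-fromℕ _)

  toℕ-last : toℕ last ≡ suc (t * 3)
  toℕ-last = Fin.toℕ-fromℕ _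

  -- The pendant edges have levels 1 and 2t+1, so a walk between them has at least 2t edges, while a
  -- rainbow walk has at most `k`. The 1 that is cancelled is the level of the first pendant edge.
  rainbow-lower-bound : ∀ k → RainbowColourable (L chain) k → t + t ≤ k
  rainbow-lower-bound k (χ , rc) =
    let p , _ , unique = rc (zero , suc zero) (penultimate , last)
          (s≤s z≤n , (λ ()) , inj₂ (inj₁ refl))
          (last> , (λ eq → Fin.<⇒≢ last> eq) , inj₂ (inj₁ (trans toℕ-last (cong suc (sym toℕ-penultimate)))))
    in ℕ.+-cancelʳ-≤ 1 (t + t) k (begin
      t + t + 1                         ≡⟨ trans (ℕ.+-comm (t + t) 1) (sym (ℕ.+-suc t t)) ⟩
      t + suc t                         ≡⟨ cong₂ _+_ (sym (row-*3 t)) (sym (row-1+*3 t)) ⟩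
      row (t * 3) + row (1 + t * 3)     ≡⟨ cong₂ _+_ (cong row (sym toℕ-penultimate)) (cong row (sym toℕ-last)) ⟩
      level (penultimate , last)        ≤⟨ level-walk χ p ⟩
      length (colours χ p) + 1          ≤⟨ ℕ.+-monoˡ-≤ 1 (unique-Fin-length unique) ⟩
      k + 1                             ∎)
    where
    open ℕ.≤-Reasoning
    last> : toℕ penultimate < toℕ last
    last> = subst₂ _<_ (sym toℕ-penultimate) (sym toℕ-last) ℕ.≤-refl

  -- Degrees in the chain and equality in the bound

  single-neighbour⇒degree : ∀ {v w} → (∀ {a} → Adj chain v a → a ≡ w) → ¬ (2 ≤ degree chain v)
  single-neighbour⇒degree {v} {w} only large = ℕ.<⇒≱ large
    (unique-length {ys = [ w ]} (Unique.filter⁺ (adj? chain v) (Unique.allFin⁺ _))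
      λ a∈ → here (only (proj₂ (∈-filter⁻ (adj? chain v) {xs = allFin _} a∈))))

  zero-neighbour : ∀ {a} → Adj chain zero a → a ≡ suc zero
  zero-neighbour (0≢a , inj₁ eq) = contradiction (Fin.toℕ-injective (sym (row≡0 _ (sym eq)))) 0≢a
  zero-neighbour (_ , inj₂ (inj₁ eq)) = Fin.toℕ-injective eq

  last-neighbour : ∀ {a} → Adj chain last a → a ≡ penultimate
  last-neighbour {a} (last≢a , inj₁ eq)
    with row≡suc (toℕ a) t (trans (sym eq) (trans (cong row toℕ-last) (row-1+*3 t)))
  ... | inj₁ a≡         = contradiction (Fin.toℕ-injective (trans toℕ-last (sym a≡))) last≢a
  -- The numbers 3t+2 and 3t+3, which would complete row t+1, lie outside `V`.
  ... | inj₂ (inj₁ a≡) = contradiction (Fin.toℕ<n a) (ℕ.<-irrefl a≡)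
  ... | inj₂ (inj₂ a≡) = contradiction (Fin.toℕ<n a) (ℕ.<⇒≯ (ℕ.≤-reflexive (sym a≡)))
  last-neighbour {a} (_ , inj₂ (inj₁ eq)) =
    contradiction (Fin.toℕ<n a) (ℕ.<-irrefl (trans eq (cong suc toℕ-last)))
  last-neighbour (_ , inj₂ (inj₂ eq)) = Fin.toℕ-injective
    (trans (ℕ.suc-injective (trans (sym eq) toℕ-last)) (sym toℕ-penultimate))

  -- The two pendant vertices have degree less than 2; put in front of the counted vertices they
  -- still form a duplicate-free list in `Fin (2 + t * 3)`.
  n₂-chain : n₂ chain ≤ t * 3
  n₂-chain = ℕ.≤-pred (ℕ.≤-pred (unique-Fin-length
    (unique-∷ zero∉ (unique-∷ last∉ (Unique.filter⁺ large? (Unique.allFin⁺ _))))))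
    where
    large? : Decidable (λ v → 2 ≤ degree chain v)
    large? v = 2 ≤? degree chain v

    last∉ : last ∉ filter large? (allFin _)
    last∉ last∈ = single-neighbour⇒degree last-neighbour (proj₂ (∈-filter⁻ large? {xs = allFin _} last∈))

    zero∉ : zero ∉ last ∷ filter large? (allFin _)
    zero∉ (here ())
    zero∉ (there zero∈) = single-neighbour⇒degree zero-neighbour (proj₂ (∈-filter⁻ large? {xs = allFin _} zero∈))

  -- The inequalities k + t ≤ n₂ ≤ 3t ≤ k + t close into a circle, so all of them are equalities.
  sharp : ∃[ k ] (HasRC (L chain) k × k + t ≡ n₂ chain)
  sharp =
    let k , rc , k+t≤n₂ = Growth.colour-bound chain-forestOfTriangles chain-connected in
    k , rc , ℕ.≤-antisym k+t≤n₂ (begin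
      n₂ chain     ≤⟨ n₂-chain ⟩
      t * 3        ≡⟨ ℕ.*-comm t 3 ⟩
      t + (t + (t + 0)) ≡⟨ cong (λ m → t + (t + m)) (ℕ.+-identityʳ t) ⟩
      t + (t + t)  ≡⟨ sym (ℕ.+-assoc t t t) ⟩
      t + t + t    ≤⟨ ℕ.+-monoˡ-≤ t (rainbow-lower-bound k (proj₁ rc)) ⟩
      k + t        ∎)
    where open ℕ.≤-Reasoning

theorem3p1 :
    (∀ (n : ℕ) (G : Graph (Fin n)) (t : ℕ) (T : Fin t → Graph (Fin n)) →
       Connected G → ForestOfTriangles G T →
       ∃[ k ] (HasRC (L G) k × k + t ≤ n₂ G))
    ×
    (∀ (t : ℕ) → 1 ≤ t →
       ∃[ n ] ∃[ G ] ∃[ T ]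
         (Connected {Fin n} G × ForestOfTriangles G {t} T ×
          ∃[ k ] (HasRC (L G) k × k + t ≡ n₂ G)))
theorem3p1 =
  (λ _ _ _ _ G-connected F → Growth.colour-bound F G-connected) ,
  λ t _ → 2 + t * 3 , Chain.chain t , Chain.rowTriangle t ,
    Chain.chain-connected t , Chain.chain-forestOfTriangles t , Chain.sharp t
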